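{- The two sets $\{Y_{S_1},Y_{C_3},Y_{S_5},Y_{S_7},\dots\}$ and $\{Y_{S_1},Y_{S_3},Y_{S_5},Y_{S_7},\dots\}$ (where $S_k$ runs over odd $k$ apart from the replacement of $S_3$ by $C_3$ in the first set) are algebraically independent generating sets of the algebra $\Gamma$. Moreover, they are the only algebraically independent generating sets of $\Gamma$ consisting of near chromatic symmetric functions.
   Context: For a finite simple graph $G$, $X_G=\sum_{\kappa}\prod_{v}x_{\kappa(v)}$ is its chromatic symmetric function (sum over proper colorings $\kappa:V\to\{1,2,\dots\}$), $\omega$ is the involution of the algebra of symmetric functions with $\omega(p_r)=(-1)^{r-1}p_r$ where $p_r=\sum_ix_i^r$, and the near chromatic symmetric function of $G$ is $Y_G=(X_G+\omega(X_G))/2$. $\Gamma=\mathbb{Q}[p_1,p_3,p_5,\dots]$. $C_3$ is the cycle on three vertices; $S_n$ ($n\ge1$) is the star graph, the tree with one internal vertex and $n-1$ leaves ($S_1$ a single vertex). -}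

module Defs where

open import Data.Nat as ℕ using (ℕ; zero; suc)
open import Data.Fin using (Fin; zero; suc; _≟_)
open import Data.Rational using (ℚ; 0ℚ; 1ℚ; ½; _+_; _*_; -_)
open import Data.List using (List; []; _∷_; map; concatMap; foldr; filterᵇ)
open import Data.List.Relation.Unary.All using (All)
open import Data.List using (allFin)
open import Data.Bool using (Bool; true; false; _∧_; _∨_; not; if_then_else_)
open import Data.Product using (Σ; _×_; _,_)
open import Data.Sum using (_⊎_)
open import Relation.Nullary using (¬_)
open import Relation.Nullary.Decidable using (⌊_⌋)
open import Relation.Binary.PropositionalEquality using (_≡_; _≢_)

sumFin : (N : ℕ) → (Fin N → ℚ) → ℚ
sumFin zero f = 0ℚ
sumFin (suc N) f = f zero + sumFin N (λ i → f (suc i))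

prodFin : (N : ℕ) → (Fin N → ℚ) → ℚ
prodFin zero f = 1ℚ
prodFin (suc N) f = f zero * prodFin N (λ i → f (suc i))

qpow : ℚ → ℕ → ℚ
qpow x zero = 1ℚ
qpow x (suc r) = x * qpow x r

-- Symmetric functions over ℚ, presented as polynomial expressions in the
-- power sums.  `psum r` denotes p_{r+1} = Σ_i x_i^{r+1}.

data PExpr : Set where
  const : ℚ → PExpr
  psum  : ℕ → PExpr
  _⊕_   : PExpr → PExpr → PExpr
  _⊗_   : PExpr → PExpr → PExpr

-- evaluation in N variables x_i := ρ i  (restriction to x_{N+1} = ... = 0)
eval : (N : ℕ) → (Fin N → ℚ) → PExpr → ℚ
eval N ρ (const c) = c
eval N ρ (psum r) = sumFin N (λ i → qpow (ρ i) (suc r))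
eval N ρ (a ⊕ b) = eval N ρ a + eval N ρ b
eval N ρ (a ⊗ b) = eval N ρ a * eval N ρ b

_≈_ : PExpr → PExpr → Set
a ≈ b = ∀ (N : ℕ) (ρ : Fin N → ℚ) → eval N ρ a ≡ eval N ρ b

infix 4 _≈_

even : ℕ → Bool
even zero = true
even (suc n) = not (even n)

-- ω : p_r ↦ (-1)^{r-1} p_r, extended as a ℚ-algebra homomorphism
ω : PExpr → PExpr
ω (const c) = const c
ω (psum r) = if even r then psum r else (const (- 1ℚ) ⊗ psum r)
ω (a ⊕ b) = ω a ⊕ ω b
ω (a ⊗ b) = ω a ⊗ ω b

-- Γ = ℚ[p1,p3,p5,...]
OnlyOdd : PExpr → Set
OnlyOdd (const c) = Data.Unit.⊤ where import Data.Unit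
OnlyOdd (psum r) = even r ≡ true
OnlyOdd (a ⊕ b) = OnlyOdd a × OnlyOdd b
OnlyOdd (a ⊗ b) = OnlyOdd a × OnlyOdd b

InΓ : PExpr → Set
InΓ q = Σ PExpr λ q' → OnlyOdd q' × q ≈ q'

record Graph : Set where
  field
    n      : ℕ
    adj    : Fin n → Fin n → Bool
    sym    : ∀ i j → adj i j ≡ adj j i
    irrefl : ∀ i → adj i i ≡ false

_==_ : {N : ℕ} → Fin N → Fin N → Bool
i == j = ⌊ i ≟ j ⌋

allBool : List Bool → Bool
allBool = foldr _∧_ true

allFuns : (n N : ℕ) → List (Fin n → Fin N)
allFuns zero N = (λ ()) ∷ []
allFuns (suc n) N =
  concatMap (λ c → map (λ f → λ { zero → c ; (suc i) → f i }) (allFuns n N)) (allFin N)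

isProper : (G : Graph) {N : ℕ} → (Fin (Graph.n G) → Fin N) → Bool
isProper G κ =
  allBool (concatMap (λ i → map (λ j → not (Graph.adj G i j ∧ (κ i == κ j)))
                                  (allFin (Graph.n G)))
                     (allFin (Graph.n G)))

sumList : List ℚ → ℚ
sumList = foldr _+_ 0ℚ

chromEval : (G : Graph) (N : ℕ) → (Fin N → ℚ) → ℚ
chromEval G N ρ =
  sumList (map (λ κ → prodFin (Graph.n G) (λ v → ρ (κ v)))
               (filterᵇ (isProper G) (allFuns (Graph.n G) N)))

RepX : Graph → PExpr → Set
RepX G x = ∀ (N : ℕ) (ρ : Fin N → ℚ) → eval N ρ x ≡ chromEval G N ρ

NearChrom : Graph → PExpr → Set
NearChrom G y = Σ PExpr λ x → RepX G x × (y ≈ const ½ ⊗ (x ⊕ ω x))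

-- star k = S_{k+1}: vertex 0 is the centre, adjacent to all others
star : ℕ → Graph
star k = record
  { n = suc k
  ; adj = sadj
  ; sym = ssym
  ; irrefl = sirr
  }
  where
  sadj : Fin (suc k) → Fin (suc k) → Bool
  sadj zero zero = false
  sadj zero (suc _) = true
  sadj (suc _) zero = true
  sadj (suc _) (suc _) = false
  ssym : ∀ i j → sadj i j ≡ sadj j i
  ssym zero zero = Relation.Binary.PropositionalEquality.refl
  ssym zero (suc _) = Relation.Binary.PropositionalEquality.refl
  ssym (suc _) zero = Relation.Binary.PropositionalEquality.refl
  ssym (suc _) (suc _) = Relation.Binary.PropositionalEquality.refl
  sirr : ∀ i → sadj i i ≡ false
  sirr zero = Relation.Binary.PropositionalEquality.refl
  sirr (suc _) = Relation.Binary.PropositionalEquality.refl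

C3 : Graph
C3 = record { n = 3 ; adj = cadj ; sym = csym ; irrefl = cirr }
  where
  open Relation.Binary.PropositionalEquality using (refl)
  cadj : Fin 3 → Fin 3 → Bool
  cadj i j = not (i == j)
  csym : ∀ i j → cadj i j ≡ cadj j i
  csym zero zero = refl
  csym zero (suc zero) = refl
  csym zero (suc (suc zero)) = refl
  csym (suc zero) zero = refl
  csym (suc zero) (suc zero) = refl
  csym (suc zero) (suc (suc zero)) = refl
  csym (suc (suc zero)) zero = refl
  csym (suc (suc zero)) (suc zero) = refl
  csym (suc (suc zero)) (suc (suc zero)) = refl
  cirr : ∀ i → cadj i i ≡ false
  cirr zero = refl
  cirr (suc zero) = refl
  cirr (suc (suc zero)) = refl

-- Formal polynomials over ℚ in k variables (Horner / dense representation)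

Poly : ℕ → Set
Poly zero = ℚ
Poly (suc k) = List (Poly k)   -- coefficients of powers of the first variable

IsZeroPoly : (k : ℕ) → Poly k → Set
IsZeroPoly zero c = c ≡ 0ℚ
IsZeroPoly (suc k) cs = All (IsZeroPoly k) cs

subst : (k : ℕ) → Poly k → (Fin k → PExpr) → PExpr
subst zero c t = const c
subst (suc k) cs t =
  foldr (λ c acc → subst k c (λ i → t (suc i)) ⊕ (t zero ⊗ acc)) (const 0ℚ) cs

-- sets of symmetric functions are predicates on PExpr (closed under ≈)
SymSet : Set₁
SymSet = PExpr → Set

Respects≈ : SymSet → Set
Respects≈ T = ∀ y y' → y ≈ y' → T y → T y'

SameSet : SymSet → SymSet → Set
SameSet T U = ∀ y → (T y → U y) × (U y → T y)

AlgIndep : SymSet → Set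
AlgIndep T = ∀ (k : ℕ) (t : Fin k → PExpr) →
  (∀ i → T (t i)) → (∀ i j → i ≢ j → ¬ (t i ≈ t j)) →
  (f : Poly k) → subst k f t ≈ const 0ℚ → IsZeroPoly k f

GeneratesΓ : SymSet → Set
GeneratesΓ T =
  (∀ y → T y → InΓ y) ×
  (∀ q → InΓ q → Σ ℕ λ k → Σ (Fin k → PExpr) λ t →
      (∀ i → T (t i)) × Σ (Poly k) λ f → q ≈ subst k f t)

SetA : SymSet
SetA y = NearChrom (star 0) y ⊎ NearChrom C3 y ⊎
         Σ ℕ (λ k → NearChrom (star (2 ℕ.* suc (suc k))) y)

SetB : SymSet
SetB y = Σ ℕ (λ k → NearChrom (star (2 ℕ.* k)) y)

{-# OPTIONS --safe #-}

-- A polynomial in the power sums is determined by its values on arbitrary sequences (p_1, p_2, …): by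
-- polynomiality it may be evaluated on alphabets with rational multiplicities, and these realise every
-- prescribed finite list of power sums.  Now Y_{S_{2i+1}} and Y_{C_3} have the form
-- c p_{2i+1} + (polynomial in p_1, p_3, …, p_{2i-1}) with c ≠ 0, so both families can be solved triangularly
-- for the odd power sums; this gives independence and generation.
--
-- For uniqueness, write X_G by deletion–contraction.  The terms of X_G fixed by ω are exactly those with
-- positive coefficient, so nothing cancels in Y_G; two disjoint edges therefore produce a term with p_2², and
-- Y_G ∉ Γ.  A graph without two disjoint edges and without isolated vertices is a star or a triangle, while
-- an isolated vertex makes X_G divisible by p_1.  On the ray where p_{2i+1} = u and the other power sums
-- vanish, Y_G then has a term linear in u only for G = S_{2i+1}, or G = C_3 and i = 1.  So a generating
-- set must contain Y_{S_{2i+1}} for each i ≠ 1, and Y_{S_3} or Y_{C_3}; by independence it contains nothing else.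

module Submission where

open import Defs
open import Data.Nat as ℕ using (ℕ; zero; suc; z≤n; s≤s)
import Data.Nat.Properties as ℕ
open import Data.Fin as Fin using (Fin; zero; suc; toℕ; fromℕ<; punchIn; punchOut)
import Data.Fin.Properties as Fin
open import Data.Rational using (ℚ; 0ℚ; 1ℚ; ½; _+_; _*_; -_; 1/_; _≤_; _<_; ≢-nonZero; nonNegative)
open import Data.Rational.Properties
open import Data.List using (List; []; _∷_; _++_; map; concatMap; foldr; filterᵇ; length; allFin; tabulate)
import Data.List.Properties as List
open import Data.List.Relation.Unary.All as All using (All; []; _∷_)
open import Data.Vec as Vec using (Vec; []; _∷_; lookup; insertAt)
import Data.Vec.Properties as Vec
open import Data.Bool using (Bool; true; false; _∧_; not; if_then_else_)
import Data.Bool.Properties as Bool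
open import Data.Product using (Σ; _×_; _,_; proj₁; proj₂)
open import Data.Sum using (_⊎_; inj₁; inj₂)
open import Data.Empty using (⊥; ⊥-elim)
open import Data.Unit using (tt)
open import Data.Maybe using (Maybe; just; nothing)
open import Function using (_∘_; id; _$_)
open import Relation.Nullary using (¬_; Dec; yes; no)
open import Relation.Nullary.Decidable using (¬?; _×-dec_)
open import Relation.Binary.PropositionalEquality as ≡ using (_≡_; _≢_; refl; sym; trans; cong; cong₂)
open import Tactic.RingSolver.Core.AlmostCommutativeRing using (AlmostCommutativeRing; fromCommutativeRing)
open import Tactic.RingSolver using (solve-∀)
open ≡.≡-Reasoning

-- Equality `≈` only tests finite alphabets, and a `PExpr` carries no degree or list of
-- coefficients. Every argument about coefficients is therefore replaced by evaluation at a chosen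
-- sequence of power sum values (`≋`). A term p_2² shows as quadratic growth along a line on which
-- the elements of Γ are constant; a missing linear term is a property stable under sums and
-- products. Likewise independence becomes a surjectivity statement: functions that can be given
-- arbitrary rational values simultaneously satisfy no polynomial relation. The uniqueness proof
-- must also decide whether a member of T equals a given generator. Since `≋` quantifies over all
-- rational sequences, this decision cannot be made by comparing values; the classification of
-- graphs by shape supplies it.

ringℚ : AlmostCommutativeRing _ _
ringℚ = fromCommutativeRing +-*-commutativeRing is0
  where
  is0 : ∀ x → Maybe (0ℚ ≡ x)
  is0 x with 0ℚ ≟ x
  ... | yes p = just p
  ... | no _  = nothing

x*y≡0⇒y≡0 : ∀ x y → x ≢ 0ℚ → x * y ≡ 0ℚ → y ≡ 0ℚ
x*y≡0⇒y≡0 x y x≢0 xy≡0 = *-cancelˡ-nonZero x (trans xy≡0 (sym (*-zeroʳ x)))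
  where
  instance _ = ≢-nonZero x≢0
  *-cancelˡ-nonZero : ∀ x .{{_ : Data.Rational.NonZero x}} {y z} → x * y ≡ x * z → y ≡ z
  *-cancelˡ-nonZero x {y} {z} e = begin
    y                ≡⟨ lem y ⟩
    1/ x * (x * y)   ≡⟨ cong (1/ x *_) e ⟩
    1/ x * (x * z)   ≡⟨ lem z ⟨
    z                ∎
    where
    lem : ∀ w → w ≡ 1/ x * (x * w)
    lem w = begin
      w               ≡⟨ *-identityˡ w ⟨
      1ℚ * w          ≡⟨ cong (_* w) (*-inverseˡ x) ⟨
      1/ x * x * w    ≡⟨ *-assoc (1/ x) x w ⟩
      1/ x * (x * w)  ∎

x*y≢0 : ∀ {x y} → x ≢ 0ℚ → y ≢ 0ℚ → x * y ≢ 0ℚ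
x*y≢0 {x} {y} x≢0 y≢0 e = y≢0 (x*y≡0⇒y≡0 x y x≢0 e)

divide : ∀ c → c ≢ 0ℚ → ∀ a → Σ ℚ λ x → c * x ≡ a
divide c c≢0 a = 1/ c * a , (begin
  c * (1/ c * a)  ≡⟨ *-assoc c (1/ c) a ⟨
  c * 1/ c * a    ≡⟨ cong (_* a) (*-inverseʳ c) ⟩
  1ℚ * a          ≡⟨ *-identityˡ a ⟩
  a               ∎)
  where instance _ = ≢-nonZero c≢0

fromℕ : ℕ → ℚ
fromℕ zero    = 0ℚ
fromℕ (suc m) = 1ℚ + fromℕ m

0≤fromℕ : ∀ m → 0ℚ ≤ fromℕ m
0≤fromℕ zero    = ≤-refl
0≤fromℕ (suc m) = +-mono-≤ (nonNegative⁻¹ 1ℚ) (0≤fromℕ m)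

1+fromℕ≢0 : ∀ m → 1ℚ + fromℕ m ≢ 0ℚ
1+fromℕ≢0 m e = <-irrefl (sym e) (+-mono-<-≤ (positive⁻¹ 1ℚ) (0≤fromℕ m))

qpow-+ : ∀ x m n → qpow x (m ℕ.+ n) ≡ qpow x m * qpow x n
qpow-+ x zero    n = sym (*-identityˡ _)
qpow-+ x (suc m) n = trans (cong (x *_) (qpow-+ x m n)) (sym (*-assoc x _ _))

-- Finite sums and products

sumFin-cong : ∀ N {f g : Fin N → ℚ} → (∀ i → f i ≡ g i) → sumFin N f ≡ sumFin N g
sumFin-cong zero    e = refl
sumFin-cong (suc N) e = cong₂ _+_ (e zero) (sumFin-cong N (e ∘ suc))

sumFin-0 : ∀ N → sumFin N (λ _ → 0ℚ) ≡ 0ℚ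
sumFin-0 zero    = refl
sumFin-0 (suc N) = trans (+-identityˡ _) (sumFin-0 N)

+-interchange : ∀ a b c d → (a + b) + (c + d) ≡ (a + c) + (b + d)
+-interchange = solve-∀ ringℚ

*-interchange : ∀ a b c d → (a * b) * (c * d) ≡ (a * c) * (b * d)
*-interchange = solve-∀ ringℚ

sumFin-+ : ∀ N (f g : Fin N → ℚ) → sumFin N (λ i → f i + g i) ≡ sumFin N f + sumFin N g
sumFin-+ zero    f g = refl
sumFin-+ (suc N) f g = trans (cong (f zero + g zero +_) (sumFin-+ N (f ∘ suc) (g ∘ suc)))
                             (+-interchange (f zero) (g zero) _ _)

sumFin-*ˡ : ∀ N c (f : Fin N → ℚ) → sumFin N (λ i → c * f i) ≡ c * sumFin N f
sumFin-*ˡ zero    c f = sym (*-zeroʳ c)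
sumFin-*ˡ (suc N) c f = trans (cong (c * f zero +_) (sumFin-*ˡ N c (f ∘ suc)))
                              (sym (*-distribˡ-+ c (f zero) _))

sumFin-*ʳ : ∀ N c (f : Fin N → ℚ) → sumFin N (λ i → f i * c) ≡ sumFin N f * c
sumFin-*ʳ N c f = trans (sumFin-cong N (λ i → *-comm (f i) c))
                        (trans (sumFin-*ˡ N c f) (*-comm c _))

sumFin-swap : ∀ M N (f : Fin M → Fin N → ℚ) →
  sumFin M (λ i → sumFin N (f i)) ≡ sumFin N (λ j → sumFin M (λ i → f i j))
sumFin-swap zero    N f = sym (sumFin-0 N)
sumFin-swap (suc M) N f = trans (cong (sumFin N (f zero) +_) (sumFin-swap M N (f ∘ suc)))
                                (sym (sumFin-+ N (f zero) _))

prodFin-cong : ∀ N {f g : Fin N → ℚ} → (∀ i → f i ≡ g i) → prodFin N f ≡ prodFin N g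
prodFin-cong zero    e = refl
prodFin-cong (suc N) e = cong₂ _*_ (e zero) (prodFin-cong N (e ∘ suc))

prodFin-1 : ∀ N → prodFin N (λ _ → 1ℚ) ≡ 1ℚ
prodFin-1 zero    = refl
prodFin-1 (suc N) = trans (*-identityˡ _) (prodFin-1 N)

prodFin-* : ∀ N (f g : Fin N → ℚ) → prodFin N (λ i → f i * g i) ≡ prodFin N f * prodFin N g
prodFin-* zero    f g = refl
prodFin-* (suc N) f g = trans (cong (f zero * g zero *_) (prodFin-* N (f ∘ suc) (g ∘ suc)))
                              (*-interchange (f zero) (g zero) _ _)

prodFin-punchIn : ∀ N (j : Fin (suc N)) (f : Fin (suc N) → ℚ) →
  prodFin (suc N) f ≡ f j * prodFin N (f ∘ punchIn j)
prodFin-punchIn N       zero    f = refl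
prodFin-punchIn (suc N) (suc j) f =
  trans (cong (f zero *_) (prodFin-punchIn N j (f ∘ suc))) (swap (f zero) (f (suc j)) _)
  where
  swap : ∀ a b c → a * (b * c) ≡ b * (a * c)
  swap = solve-∀ ringℚ

-- Evaluation and arithmetic of dense polynomials; univariate polynomials are Poly 1

evP : (k : ℕ) → Poly k → (Fin k → ℚ) → ℚ
evP zero    c  a = c
evP (suc k) cs a = foldr (λ c acc → evP k c (a ∘ suc) + a zero * acc) 0ℚ cs

constP : ∀ k → ℚ → Poly k
constP zero    c = c
constP (suc k) c = constP k c ∷ []

addP : ∀ k → Poly k → Poly k → Poly k
addP zero    p       q       = p + q
addP (suc k) []      q       = q
addP (suc k) (c ∷ p) []      = c ∷ p
addP (suc k) (c ∷ p) (d ∷ q) = addP k c d ∷ addP (suc k) p q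

mulP : ∀ k → Poly k → Poly k → Poly k
mulP zero    p       q = p * q
mulP (suc k) []      q = []
mulP (suc k) (c ∷ p) q = addP (suc k) (map (mulP k c) q) (constP k 0ℚ ∷ mulP (suc k) p q)

varP : ∀ k → Fin k → Poly k
varP (suc k) zero    = constP k 0ℚ ∷ constP k 1ℚ ∷ []
varP (suc k) (suc i) = varP k i ∷ []

evP-const : ∀ k c a → evP k (constP k c) a ≡ c
evP-const zero    c a = refl
evP-const (suc k) c a = trans (cong₂ _+_ (evP-const k c (a ∘ suc)) (*-zeroʳ (a zero))) (+-identityʳ c)

evP-add : ∀ k p q a → evP k (addP k p q) a ≡ evP k p a + evP k q a
evP-add zero    p       q       a = refl
evP-add (suc k) []      q       a = sym (+-identityˡ _)
evP-add (suc k) (c ∷ p) []      a = sym (+-identityʳ _)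
evP-add (suc k) (c ∷ p) (d ∷ q) a =
  trans (cong₂ (λ u v → u + a zero * v) (evP-add k c d (a ∘ suc)) (evP-add (suc k) p q a))
        (lem (evP k c _) (evP k d _) (a zero) _ _)
  where
  lem : ∀ c d x p q → (c + d) + x * (p + q) ≡ (c + x * p) + (d + x * q)
  lem = solve-∀ ringℚ

evP-mul : ∀ k p q a → evP k (mulP k p q) a ≡ evP k p a * evP k q a
evP-mul zero    p       q a = refl
evP-mul (suc k) []      q a = sym (*-zeroˡ (evP (suc k) q a))
evP-mul (suc k) (c ∷ p) q a = begin
  evP (suc k) (mulP (suc k) (c ∷ p) q) a
    ≡⟨ evP-add (suc k) (map (mulP k c) q) _ a ⟩
  evP (suc k) (map (mulP k c) q) a + (evP k (constP k 0ℚ) (a ∘ suc) + a zero * evP (suc k) (mulP (suc k) p q) a)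
    ≡⟨ cong₂ _+_ (scale q) (cong₂ (λ u v → u + a zero * v) (evP-const k 0ℚ _) (evP-mul (suc k) p q a)) ⟩
  evP k c (a ∘ suc) * evP (suc k) q a + (0ℚ + a zero * (evP (suc k) p a * evP (suc k) q a))
    ≡⟨ lem (evP k c (a ∘ suc)) (a zero) _ _ ⟩
  evP (suc k) (c ∷ p) a * evP (suc k) q a ∎
  where
  lem : ∀ c x p q → c * q + (0ℚ + x * (p * q)) ≡ (c + x * p) * q
  lem = solve-∀ ringℚ
  lem′ : ∀ c d x q → c * d + x * (c * q) ≡ c * (d + x * q)
  lem′ = solve-∀ ringℚ
  scale : ∀ q → evP (suc k) (map (mulP k c) q) a ≡ evP k c (a ∘ suc) * evP (suc k) q a
  scale []      = sym (*-zeroʳ (evP k c (a ∘ suc)))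
  scale (d ∷ q) = trans (cong₂ (λ u v → u + a zero * v) (evP-mul k c d (a ∘ suc)) (scale q))
                        (lem′ (evP k c (a ∘ suc)) _ (a zero) _)

evP-var : ∀ k i a → evP k (varP k i) a ≡ a i
evP-var (suc k) zero a =
  trans (cong₂ (λ u v → u + a zero * (v + a zero * 0ℚ)) (evP-const k 0ℚ _) (evP-const k 1ℚ _))
        (lem (a zero))
  where
  lem : ∀ x → 0ℚ + x * (1ℚ + x * 0ℚ) ≡ x
  lem = solve-∀ ringℚ
evP-var (suc k) (suc i) a =
  trans (cong₂ _+_ (evP-var k i (a ∘ suc)) (*-zeroʳ (a zero))) (+-identityʳ _)

evP-cong : ∀ k p {a b : Fin k → ℚ} → (∀ i → a i ≡ b i) → evP k p a ≡ evP k p b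
evP-cong zero    c        e = refl
evP-cong (suc k) []       e = refl
evP-cong (suc k) (c ∷ cs) e =
  cong₂ _+_ (evP-cong k c (e ∘ suc)) (cong₂ _*_ (e zero) (evP-cong (suc k) cs e))

-- Zeros of polynomials

ev₁ : Poly 1 → ℚ → ℚ
ev₁ p x = evP 1 p (λ _ → x)

-- Synthetic division: the coefficients of the quotient are the partial Horner values at `a`.
divideRoot : ∀ c p a → Σ (Poly 1) λ q → length q ≡ length p ×
  (∀ x → ev₁ (c ∷ p) x ≡ ev₁ (c ∷ p) a + (x + - a) * ev₁ q x)
divideRoot c []      a = [] , refl , λ x → lem c x a
  where
  lem : ∀ c x a → c + x * 0ℚ ≡ (c + a * 0ℚ) + (x + - a) * 0ℚ
  lem = solve-∀ ringℚ
divideRoot c (d ∷ p) a with divideRoot d p a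
... | q , eq , e = ev₁ (d ∷ p) a ∷ q , cong suc eq , λ x →
  trans (cong (λ z → c + x * z) (e x)) (lem c x a _ _)
  where
  lem : ∀ c x a e q → c + x * (e + (x + - a) * q) ≡ (c + a * e) + (x + - a) * (e + x * q)
  lem = solve-∀ ringℚ

-- Dividing by x - a leaves a shorter polynomial that vanishes at a + 1, a + 2, ..., so the starting
-- point must be arbitrary for the induction.
vanishes : ∀ n (p : Poly 1) → length p ≡ n → ∀ a → (∀ m → ev₁ p (a + fromℕ m) ≡ 0ℚ) → ∀ x → ev₁ p x ≡ 0ℚ
vanishes zero    []      _  a z x = refl
vanishes (suc n) (c ∷ p) eq a z x with divideRoot c p a
... | q , eq′ , e = trans (factor x) (trans (cong ((x + - a) *_) (vanishes n q (trans eq′ (ℕ.suc-injective eq)) (a + 1ℚ) roots x)) (*-zeroʳ (x + - a)))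
  where
  factor : ∀ x → ev₁ (c ∷ p) x ≡ (x + - a) * ev₁ q x
  factor x = trans (e x) (trans (cong (_+ (x + - a) * ev₁ q x)
    (trans (cong (ev₁ (c ∷ p)) (sym (+-identityʳ a))) (z 0))) (+-identityˡ _))
  lem : ∀ a m → (a + (1ℚ + m)) + - a ≡ 1ℚ + m
  lem = solve-∀ ringℚ
  roots : ∀ m → ev₁ q (a + 1ℚ + fromℕ m) ≡ 0ℚ
  roots m = x*y≡0⇒y≡0 (1ℚ + fromℕ m) _ (1+fromℕ≢0 m) (begin
    (1ℚ + fromℕ m) * ev₁ q (a + 1ℚ + fromℕ m)
      ≡⟨ cong₂ _*_ (sym (lem a (fromℕ m))) (cong (ev₁ q) (+-assoc a 1ℚ (fromℕ m))) ⟩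
    ((a + (1ℚ + fromℕ m)) + - a) * ev₁ q (a + (1ℚ + fromℕ m))
      ≡⟨ factor (a + (1ℚ + fromℕ m)) ⟨
    ev₁ (c ∷ p) (a + fromℕ (suc m)) ≡⟨ z (suc m) ⟩
    0ℚ ∎)

-- The value at 0 is the constant coefficient. The tail is then known to vanish away from 0 only;
-- its zeros 1, 2, 3, ... suffice to remove this exception.
vanishes⇒coeffs≡0 : ∀ (p : Poly 1) → (∀ x → ev₁ p x ≡ 0ℚ) → All (_≡ 0ℚ) p
vanishes⇒coeffs≡0 []      z = []
vanishes⇒coeffs≡0 (c ∷ p) z = c≡0 ∷ vanishes⇒coeffs≡0 p (vanishes (length p) p refl 1ℚ λ m →
    x*y≡0⇒y≡0 (1ℚ + fromℕ m) _ (1+fromℕ≢0 m) (tail (1ℚ + fromℕ m)))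
  where
  c≡0 : c ≡ 0ℚ
  c≡0 = trans (sym (+-identityʳ c)) (trans (cong (c +_) (sym (*-zeroˡ (ev₁ p 0ℚ)))) (z 0ℚ))
  tail : ∀ x → x * ev₁ p x ≡ 0ℚ
  tail x = trans (sym (+-identityˡ _)) (trans (cong (_+ x * ev₁ p x) (sym c≡0)) (z x))

-- With all variables but the first fixed, the univariate case shows that each coefficient vanishes
-- at every point, and induction applies to the coefficients.
evP≡0⇒IsZeroPoly : ∀ k f → (∀ a → evP k f a ≡ 0ℚ) → IsZeroPoly k f
evP≡0⇒IsZeroPoly zero    c  z = z (λ ())
evP≡0⇒IsZeroPoly (suc k) cs z = All.map (λ {c} → evP≡0⇒IsZeroPoly k c) (commute cs coeffs)
  where
  specialise : (a : Fin k → ℚ) → List (Poly k) → Poly 1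
  specialise a = map (λ c → evP k c a)
  extend : ℚ → (Fin k → ℚ) → Fin (suc k) → ℚ
  extend x a zero    = x
  extend x a (suc i) = a i
  ev-specialise : ∀ a x cs → ev₁ (specialise a cs) x ≡ evP (suc k) cs (extend x a)
  ev-specialise a x []       = refl
  ev-specialise a x (c ∷ cs) = cong (λ z → evP k c a + x * z) (ev-specialise a x cs)
  all-map : ∀ a cs → All (_≡ 0ℚ) (specialise a cs) → All (λ c → evP k c a ≡ 0ℚ) cs
  all-map a []       []       = []
  all-map a (c ∷ cs) (e ∷ es) = e ∷ all-map a cs es
  coeffs : ∀ a → All (λ c → evP k c a ≡ 0ℚ) cs
  coeffs a = all-map a cs (vanishes⇒coeffs≡0 (specialise a cs) λ x → trans (ev-specialise a x cs) (z (extend x a)))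
  commute : ∀ cs → (∀ a → All (λ c → evP k c a ≡ 0ℚ) cs) → All (λ c → ∀ a → evP k c a ≡ 0ℚ) cs
  commute []       h = []
  commute (c ∷ cs) h = (λ a → All.head (h a)) ∷ commute cs (λ a → All.tail (h a))

-- Algebraic independence of the power sums

-- Power sums are treated as independent variables here: `s r` is the value of p_{r+1}, whether or
-- not an alphabet realises it.
pe : (ℕ → ℚ) → PExpr → ℚ
pe s (const c) = c
pe s (psum r)  = s r
pe s (a ⊕ b)   = pe s a + pe s b
pe s (a ⊗ b)   = pe s a * pe s b

mom : (N : ℕ) → (Fin N → ℚ) → ℕ → ℚ
mom N ρ r = sumFin N (λ i → qpow (ρ i) (suc r))

eval≡pe : ∀ N ρ q → eval N ρ q ≡ pe (mom N ρ) q
eval≡pe N ρ (const c) = refl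
eval≡pe N ρ (psum r)  = refl
eval≡pe N ρ (a ⊕ b)   = cong₂ _+_ (eval≡pe N ρ a) (eval≡pe N ρ b)
eval≡pe N ρ (a ⊗ b)   = cong₂ _*_ (eval≡pe N ρ a) (eval≡pe N ρ b)

-- An exclusive bound on the indices that occur, not a degree: values `s r` with r at least `supp q`
-- do not influence `q`.
supp : PExpr → ℕ
supp (const c) = 0
supp (psum r)  = suc r
supp (a ⊕ b)   = supp a ℕ.⊔ supp b
supp (a ⊗ b)   = supp a ℕ.⊔ supp b

pe-cong-supp : ∀ {s s′} q → (∀ r → r ℕ.< supp q → s r ≡ s′ r) → pe s q ≡ pe s′ q
pe-cong-supp (const c) e = refl
pe-cong-supp (psum r)  e = e r ℕ.≤-refl
pe-cong-supp (a ⊕ b)   e = cong₂ _+_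
  (pe-cong-supp a (λ r r< → e r (ℕ.m<n⇒m<n⊔o (supp b) r<)))
  (pe-cong-supp b (λ r r< → e r (ℕ.m<n⇒m<o⊔n (supp a) r<)))
pe-cong-supp (a ⊗ b)   e = cong₂ _*_
  (pe-cong-supp a (λ r r< → e r (ℕ.m<n⇒m<n⊔o (supp b) r<)))
  (pe-cong-supp b (λ r r< → e r (ℕ.m<n⇒m<o⊔n (supp a) r<)))

pe-cong : ∀ {s s′} q → (∀ r → s r ≡ s′ r) → pe s q ≡ pe s′ q
pe-cong q e = pe-cong-supp q (λ r _ → e r)

pe-line : ∀ q (s v : ℕ → ℚ) → Σ (Poly 1) λ p → ∀ c → pe (λ r → s r + c * v r) q ≡ ev₁ p c
pe-line (const c) s v = constP 1 c , λ x → sym (evP-const 1 c (λ _ → x))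
pe-line (psum r)  s v = s r ∷ v r ∷ [] , λ x → lem (s r) x (v r)
  where
  lem : ∀ a x b → a + x * b ≡ a + x * (b + x * 0ℚ)
  lem = solve-∀ ringℚ
pe-line (a ⊕ b)   s v with pe-line a s v | pe-line b s v
... | p , e | q , e′ = addP 1 p q , λ x → trans (cong₂ _+_ (e x) (e′ x)) (sym (evP-add 1 p q (λ _ → x)))
pe-line (a ⊗ b)   s v with pe-line a s v | pe-line b s v
... | p , e | q , e′ = mulP 1 p q , λ x → trans (cong₂ _*_ (e x) (e′ x)) (sym (evP-mul 1 p q (λ _ → x)))

-- A list of pairs (c , a) stands for the alphabet containing each a with rational multiplicity c.
lin : List (ℚ × ℚ) → ℕ → ℚ
lin []             r = 0ℚ
lin ((c , a) ∷ cs) r = c * qpow a (suc r) + lin cs r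

lin-++ : ∀ cs ds r → lin (cs ++ ds) r ≡ lin cs r + lin ds r
lin-++ []             ds r = sym (+-identityˡ _)
lin-++ ((c , a) ∷ cs) ds r = trans (cong (c * qpow a (suc r) +_) (lin-++ cs ds r))
                                   (sym (+-assoc (c * qpow a (suc r)) _ _))

scale : ℚ → ℚ × ℚ → ℚ × ℚ
scale k (c , a) = k * c , a

dilate : ℚ → ℚ × ℚ → ℚ × ℚ
dilate k (c , a) = c , k * a

lin-scale : ∀ k cs r → lin (map (scale k) cs) r ≡ k * lin cs r
lin-scale k []             r = sym (*-zeroʳ k)
lin-scale k ((c , a) ∷ cs) r = trans (cong (k * c * qpow a (suc r) +_) (lin-scale k cs r))
                                     (lem k c _ _)
  where
  lem : ∀ k c x y → k * c * x + k * y ≡ k * (c * x + y)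
  lem = solve-∀ ringℚ

qpow-* : ∀ x y r → qpow (x * y) r ≡ qpow x r * qpow y r
qpow-* x y zero    = refl
qpow-* x y (suc r) = trans (cong (x * y *_) (qpow-* x y r)) (*-interchange x y _ _)

lin-dilate : ∀ k cs r → lin (map (dilate k) cs) r ≡ qpow k (suc r) * lin cs r
lin-dilate k []             r = sym (*-zeroʳ (qpow k (suc r)))
lin-dilate k ((c , a) ∷ cs) r =
  trans (cong₂ _+_ (cong (c *_) (qpow-* k a (suc r))) (lin-dilate k cs r)) (lem c (qpow k (suc r)) _ _)
  where
  lem : ∀ c k x y → c * (k * x) + k * y ≡ k * (c * x + y)
  lem = solve-∀ ringℚ

-- Along the multiplicity c of one letter the value is a polynomial in c. It vanishes for natural c,
-- where the copies form an honest alphabet, hence for every rational c.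
vanishes-on-virtual : ∀ q → (∀ N ρ → pe (mom N ρ) q ≡ 0ℚ) →
  ∀ cs N ρ → pe (λ r → mom N ρ r + lin cs r) q ≡ 0ℚ
vanishes-on-virtual q z []             N ρ = trans (pe-cong q (λ r → +-identityʳ _)) (z N ρ)
vanishes-on-virtual q z ((c , a) ∷ cs) N ρ with pe-line q (λ r → mom N ρ r + lin cs r) (λ r → qpow a (suc r))
... | p , e = trans (pe-cong q (λ r → lem₁ (mom N ρ r) (lin cs r) (c * qpow a (suc r))))
                    (trans (e c) (vanishes (length p) p refl 0ℚ roots c))
  where
  lem₁ : ∀ m l x → m + (x + l) ≡ (m + l) + x
  lem₁ = solve-∀ ringℚ
  lem₀ : ∀ m x → m + 0ℚ * x ≡ m
  lem₀ = solve-∀ ringℚ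
  lem₂ : ∀ m l k x → (m + l) + (1ℚ + k) * x ≡ ((x + m) + l) + k * x
  lem₂ = solve-∀ ringℚ
  adjoin : ∀ {M} → (Fin M → ℚ) → Fin (suc M) → ℚ
  adjoin σ zero    = a
  adjoin σ (suc i) = σ i
  -- The m copies of `a` move one at a time into the honest alphabet, so the statement must range
  -- over all alphabets `σ`.
  integral : ∀ m M σ → pe (λ r → (mom M σ r + lin cs r) + fromℕ m * qpow a (suc r)) q ≡ 0ℚ
  integral zero    M σ = trans (pe-cong q (λ r → lem₀ (mom M σ r + lin cs r) (qpow a (suc r))))
                               (vanishes-on-virtual q z cs M σ)
  integral (suc m) M σ = trans (pe-cong q (λ r → lem₂ (mom M σ r) (lin cs r) (fromℕ m) (qpow a (suc r))))
                               (integral m (suc M) (adjoin σ))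
  roots : ∀ m → ev₁ p (0ℚ + fromℕ m) ≡ 0ℚ
  roots m = trans (cong (ev₁ p) (+-identityˡ (fromℕ m))) (trans (sym (e (fromℕ m))) (integral m N ρ))

2ℚ : ℚ
2ℚ = 1ℚ + 1ℚ

double : ∀ x → 2ℚ * x ≡ x + x
double x = trans (*-distribʳ-+ x 1ℚ 1ℚ) (cong₂ _+_ (*-identityˡ x) (*-identityˡ x))

0<2^ : ∀ r → 0ℚ < qpow 2ℚ r
0<2^ zero    = positive⁻¹ 1ℚ
0<2^ (suc r) = ≡.subst (0ℚ <_) (sym (double (qpow 2ℚ r))) (+-mono-< (0<2^ r) (0<2^ r))

2^-step : ∀ r → qpow 2ℚ r < qpow 2ℚ (suc r)
2^-step r = ≡.subst₂ _<_ (+-identityˡ _) (sym (double (qpow 2ℚ r))) (+-monoˡ-< (qpow 2ℚ r) (0<2^ r))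

2^-mono : ∀ M k → qpow 2ℚ M < qpow 2ℚ (suc (k ℕ.+ M))
2^-mono M zero    = 2^-step M
2^-mono M (suc k) = <-trans (2^-mono M k) (2^-step (suc (k ℕ.+ M)))

x-y≢0 : ∀ {x y} → y < x → x + - y ≢ 0ℚ
x-y≢0 {x} {y} y<x e = <-irrefl (sym e) (≡.subst (_< x + - y) (+-inverseʳ y) (+-monoˡ-< (- y) y<x))

-- Dilation by 2 acts on p_{r+1} as 2^{r+1}, so composing the operators (dilation - 2^{j+1}) for j < M kills the first M power sums and no others.
killer : ℕ → List (ℚ × ℚ)
killer zero    = (1ℚ , 1ℚ) ∷ []
killer (suc M) = map (dilate 2ℚ) (killer M) ++ map (scale (- qpow 2ℚ (suc M))) (killer M)

lin-killer : ∀ M r → lin (killer (suc M)) r ≡ (qpow 2ℚ (suc r) + - qpow 2ℚ (suc M)) * lin (killer M) r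
lin-killer M r = trans (lin-++ (map (dilate 2ℚ) (killer M)) _ r)
  (trans (cong₂ _+_ (lin-dilate 2ℚ (killer M) r) (lin-scale (- qpow 2ℚ (suc M)) (killer M) r))
         (sym (*-distribʳ-+ (lin (killer M) r) (qpow 2ℚ (suc r)) (- qpow 2ℚ (suc M)))))

killer-below : ∀ M r → r ℕ.< M → lin (killer M) r ≡ 0ℚ
killer-below (suc M) r (s≤s r≤M) with ℕ.m≤n⇒m<n∨m≡n r≤M
... | inj₁ r<M  = trans (lin-killer M r) (trans (cong ((qpow 2ℚ (suc r) + - qpow 2ℚ (suc M)) *_) (killer-below M r r<M)) (*-zeroʳ (qpow 2ℚ (suc r) + - qpow 2ℚ (suc M))))
... | inj₂ refl = trans (lin-killer M r) (trans (cong (_* lin (killer M) r) (+-inverseʳ (qpow 2ℚ (suc r)))) (*-zeroˡ (lin (killer M) r)))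

-- The surviving factors are 2^{r+1} - 2^{j+1} with j < M ≤ r, all positive.
killer-above : ∀ M k → lin (killer M) (k ℕ.+ M) ≢ 0ℚ
killer-above zero    k e = 1≢0 (trans (sym lem) e)
  where
  qpow-1 : ∀ r → qpow 1ℚ r ≡ 1ℚ
  qpow-1 zero    = refl
  qpow-1 (suc r) = trans (*-identityˡ _) (qpow-1 r)
  lem : lin (killer 0) (k ℕ.+ 0) ≡ 1ℚ
  lem = cong (λ x → 1ℚ * x + 0ℚ) (qpow-1 (suc (k ℕ.+ 0)))
killer-above (suc M) k e rewrite ℕ.+-suc k M =
  x*y≢0 (x-y≢0 (2^-mono (suc M) k)) (killer-above M (suc k))
    (trans (cong (λ z → (qpow 2ℚ (suc z) + - qpow 2ℚ (suc M)) * lin (killer M) (suc (k ℕ.+ M))) (ℕ.+-suc k M))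
           (trans (sym (lin-killer M (suc (k ℕ.+ M)))) e))

-- As in Newton interpolation, a multiple of `killer M` corrects the value at index M without
-- disturbing the smaller indices.
interpolate : ∀ M (s : ℕ → ℚ) → Σ (List (ℚ × ℚ)) λ cs → ∀ r → r ℕ.< M → lin cs r ≡ s r
interpolate zero    s = [] , λ r ()
interpolate (suc M) s with interpolate M s
... | cs , e with divide (lin (killer M) M) (killer-above M 0) (s M + - lin cs M)
... | k , ek = map (scale k) (killer M) ++ cs , at
  where
  split : ∀ r → lin (map (scale k) (killer M) ++ cs) r ≡ k * lin (killer M) r + lin cs r
  split r = trans (lin-++ (map (scale k) (killer M)) cs r) (cong (_+ lin cs r) (lin-scale k (killer M) r))
  lem : ∀ x y → (x + - y) + y ≡ x
  lem = solve-∀ ringℚ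
  at : ∀ r → r ℕ.< suc M → lin (map (scale k) (killer M) ++ cs) r ≡ s r
  at r (s≤s r≤M) with ℕ.m≤n⇒m<n∨m≡n r≤M
  ... | inj₁ r<M  = trans (split r) (trans (cong₂ (λ x y → k * x + y) (killer-below M r r<M) (e r r<M))
                          (trans (cong (_+ s r) (*-zeroʳ k)) (+-identityˡ _)))
  ... | inj₂ refl = trans (split r) (trans (cong (_+ lin cs r) (trans (*-comm k _) ek)) (lem (s r) (lin cs r)))

infix 4 _≋_
_≋_ : PExpr → PExpr → Set
a ≋ b = ∀ s → pe s a ≡ pe s b

≋⇒≈ : ∀ {a b} → a ≋ b → a ≈ b
≋⇒≈ {a} {b} e N ρ = trans (eval≡pe N ρ a) (trans (e (mom N ρ)) (sym (eval≡pe N ρ b)))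

-- The difference involves finitely many power sums, and a virtual alphabet realises any values for
-- these; this is the algebraic independence of the power sums.
≈⇒≋ : ∀ {a b} → a ≈ b → a ≋ b
≈⇒≋ {a} {b} a≈b s with interpolate (supp (a ⊕ (const (- 1ℚ) ⊗ b))) s
... | cs , e = x-y≡0⇒x≡y (trans
    (sym (pe-cong-supp d λ r r< → trans (+-identityˡ (lin cs r)) (e r r<)))
    (vanishes-on-virtual d d≡0 cs 0 (λ ())))
  where
  d = a ⊕ (const (- 1ℚ) ⊗ b)
  x-x≡0 : ∀ x → x + - 1ℚ * x ≡ 0ℚ
  x-x≡0 = solve-∀ ringℚ
  x-y≡0⇒x≡y : ∀ {x y} → x + - 1ℚ * y ≡ 0ℚ → x ≡ y
  x-y≡0⇒x≡y {x} {y} h = trans (lem x y) (trans (cong (_+ y) h) (+-identityˡ y))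
    where
    lem : ∀ x y → x ≡ (x + - 1ℚ * y) + y
    lem = solve-∀ ringℚ
  d≡0 : ∀ N ρ → pe (mom N ρ) d ≡ 0ℚ
  d≡0 N ρ = trans (cong (λ z → z + - 1ℚ * pe (mom N ρ) b)
    (trans (sym (eval≡pe N ρ a)) (trans (a≈b N ρ) (eval≡pe N ρ b)))) (x-x≡0 (pe (mom N ρ) b))

-- The involution ω on values: p_{r+1} with r odd changes sign.

sgn : ℕ → ℚ
sgn r = if even r then 1ℚ else - 1ℚ

ωs : (ℕ → ℚ) → ℕ → ℚ
ωs s r = sgn r * s r

pe-ω : ∀ s q → pe s (ω q) ≡ pe (ωs s) q
pe-ω s (const c) = refl
pe-ω s (psum r) with even r
... | true  = sym (*-identityˡ (s r))
... | false = refl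
pe-ω s (a ⊕ b)   = cong₂ _+_ (pe-ω s a) (pe-ω s b)
pe-ω s (a ⊗ b)   = cong₂ _*_ (pe-ω s a) (pe-ω s b)

pe-OnlyOdd : ∀ {s s′} q → OnlyOdd q → (∀ r → even r ≡ true → s r ≡ s′ r) → pe s q ≡ pe s′ q
pe-OnlyOdd (const c) _       e = refl
pe-OnlyOdd (psum r)  h       e = e r h
pe-OnlyOdd (a ⊕ b)   (h , k) e = cong₂ _+_ (pe-OnlyOdd a h e) (pe-OnlyOdd b k e)
pe-OnlyOdd (a ⊗ b)   (h , k) e = cong₂ _*_ (pe-OnlyOdd a h e) (pe-OnlyOdd b k e)

pe-subst : ∀ k f t s → pe s (subst k f t) ≡ evP k f (pe s ∘ t)
pe-subst zero    c        t s = refl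
pe-subst (suc k) []       t s = refl
pe-subst (suc k) (c ∷ cs) t s =
  cong₂ (λ x y → x + pe s (t zero) * y) (pe-subst k c (t ∘ suc) s) (pe-subst (suc k) cs t s)

-- Families b_i = c_i p_{2i+1} + (terms in p_1, …, p_{2i-1}) are free generators of Γ

even⇒2* : ∀ r → even r ≡ true → Σ ℕ λ i → r ≡ 2 ℕ.* i
even⇒2* zero          _ = 0 , refl
even⇒2* (suc (suc r)) h with even⇒2* r (trans (sym (Bool.not-involutive (even r))) h)
... | i , refl = suc i , sym (ℕ.*-suc 2 i)

even-2* : ∀ i → even (2 ℕ.* i) ≡ true
even-2* zero    = refl
even-2* (suc i) rewrite ℕ.+-suc i (i ℕ.+ 0) = trans (Bool.not-involutive _) (even-2* i)

overwrite : ℕ → ℚ → (ℕ → ℚ) → ℕ → ℚ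
overwrite i x s r with r ℕ.≟ i
... | yes _ = x
... | no _  = s r

overwrite-at : ∀ i x s → overwrite i x s i ≡ x
overwrite-at i x s with i ℕ.≟ i
... | yes _  = refl
... | no i≢i = ⊥-elim (i≢i refl)

overwrite-off : ∀ i x s r → r ≢ i → overwrite i x s r ≡ s r
overwrite-off i x s r r≢i with r ℕ.≟ i
... | yes r≡i = ⊥-elim (r≢i r≡i)
... | no _    = refl

-- Turns values for finitely many generators, listed by distinct indices, into a target for
-- `prescribe`, which needs one sequence and a bound.
extendInjective : ∀ k (g : Fin k → ℕ) → (∀ i j → g i ≡ g j → i ≡ j) → (a : Fin k → ℚ) →
  Σ (ℕ → ℚ) λ A → Σ ℕ λ K → ∀ j → A (g j) ≡ a j × g j ℕ.< K
extendInjective zero    g inj a = (λ _ → 0ℚ) , 0 , λ ()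
extendInjective (suc k) g inj a
  with extendInjective k (g ∘ suc) (λ i j e → Fin.suc-injective (inj _ _ e)) (a ∘ suc)
... | A , K , h = overwrite (g zero) (a zero) A , suc (g zero ℕ.⊔ K) , at
  where
  at : ∀ j → overwrite (g zero) (a zero) A (g j) ≡ a j × g j ℕ.< suc (g zero ℕ.⊔ K)
  at zero    = overwrite-at (g zero) (a zero) A , s≤s (ℕ.m≤m⊔n (g zero) K)
  at (suc j) = trans (overwrite-off (g zero) (a zero) A (g (suc j)) (λ e → 0≢1+n (inj _ _ e))) (proj₁ (h j))
             , ℕ.m≤n⇒m≤1+n (ℕ.≤-trans (proj₂ (h j)) (ℕ.m≤n⊔m (g zero) K))
    where
    0≢1+n : ∀ {n} {i : Fin n} → suc i ≢ zero
    0≢1+n ()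

constP-1≢0 : ∀ k → ¬ IsZeroPoly k (constP k 1ℚ)
constP-1≢0 zero    ()
constP-1≢0 (suc k) (z ∷ _) = constP-1≢0 k z

record Triangular (b : ℕ → PExpr) : Set where
  field
    coeff   : ℕ → ℚ
    coeff≢0 : ∀ i → coeff i ≢ 0ℚ
    rest    : ℕ → PExpr
    odd     : ∀ i → OnlyOdd (rest i)
    -- Since `psum r` is p_{r+1}, this bound together with `odd` leaves p_1, p_3, ..., p_{2i-1}.
    below   : ∀ i → supp (rest i) ℕ.≤ 2 ℕ.* i
    split   : ∀ i s → pe s (b i) ≡ coeff i * s (2 ℕ.* i) + pe s (rest i)

  -- Changing the value at index 2K leaves `b i` with i < K untouched, so each new equation can be
  -- solved for that value without spoiling the earlier ones.
  prescribe : ∀ K (A : ℕ → ℚ) → Σ (ℕ → ℚ) λ s → ∀ i → i ℕ.< K → pe s (b i) ≡ A i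
  prescribe zero    A = (λ _ → 0ℚ) , λ _ ()
  prescribe (suc K) A with prescribe K A
  ... | s , h with divide (coeff K) (coeff≢0 K) (A K + - pe s (rest K))
  ... | x , cx = s′ , at
    where
    s′ : ℕ → ℚ
    s′ = overwrite (2 ℕ.* K) x s
    unchanged : ∀ i → i ℕ.≤ K → pe s′ (rest i) ≡ pe s (rest i)
    unchanged i i≤K = pe-cong-supp (rest i) λ r r< → overwrite-off (2 ℕ.* K) x s r
      (ℕ.<⇒≢ (ℕ.<-≤-trans r< (ℕ.≤-trans (below i) (ℕ.*-monoʳ-≤ 2 i≤K))))
    lem : ∀ a r → (a + - r) + r ≡ a
    lem = solve-∀ ringℚ
    at : ∀ i → i ℕ.< suc K → pe s′ (b i) ≡ A i
    at i (s≤s i≤K) with ℕ.m≤n⇒m<n∨m≡n i≤K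
    ... | inj₁ i<K  = begin
      pe s′ (b i)                               ≡⟨ split i s′ ⟩
      coeff i * s′ (2 ℕ.* i) + pe s′ (rest i)   ≡⟨ cong₂ (λ u v → coeff i * u + v) (overwrite-off (2 ℕ.* K) x s _ (ℕ.<⇒≢ (ℕ.*-monoʳ-< 2 i<K))) (unchanged i i≤K) ⟩
      coeff i * s (2 ℕ.* i) + pe s (rest i)     ≡⟨ split i s ⟨
      pe s (b i)                                ≡⟨ h i i<K ⟩
      A i                                       ∎
    ... | inj₂ refl = begin
      pe s′ (b i)                               ≡⟨ split i s′ ⟩
      coeff i * s′ (2 ℕ.* i) + pe s′ (rest i)   ≡⟨ cong₂ (λ u v → coeff i * u + v) (overwrite-at (2 ℕ.* i) x s) (unchanged i i≤K) ⟩
      coeff i * x + pe s (rest i)               ≡⟨ cong (_+ pe s (rest i)) cx ⟩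
      (A i + - pe s (rest i)) + pe s (rest i)   ≡⟨ lem (A i) _ ⟩
      A i                                       ∎

  distinct : ∀ i j → b i ≋ b j → i ≡ j
  distinct i j e with i ℕ.≟ j
  ... | yes i≡j = i≡j
  ... | no i≢j with prescribe (suc (i ℕ.⊔ j)) (overwrite i 1ℚ (λ _ → 0ℚ))
  ... | s , h = ⊥-elim (1≢0 (begin
    1ℚ          ≡⟨ overwrite-at i 1ℚ (λ _ → 0ℚ) ⟨
    _           ≡⟨ h i (s≤s (ℕ.m≤m⊔n i j)) ⟨
    pe s (b i)  ≡⟨ e s ⟩
    pe s (b j)  ≡⟨ h j (s≤s (ℕ.m≤n⊔m i j)) ⟩
    _           ≡⟨ overwrite-off i 1ℚ (λ _ → 0ℚ) j (i≢j ∘ sym) ⟩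
    0ℚ          ∎))

  -- Pairwise different members have different indices, so by `prescribe` they attain every rational
  -- point; a relation between them is a polynomial that vanishes everywhere.
  algIndep : ∀ (T : SymSet) → (∀ y → T y → Σ ℕ λ i → y ≋ b i) → AlgIndep T
  algIndep T index k t Tt t≉ f f≈0 = evP≡0⇒IsZeroPoly k f zeroAt
    where
    idx : Fin k → ℕ
    idx j = proj₁ (index (t j) (Tt j))
    t≋b : ∀ j → t j ≋ b (idx j)
    t≋b j = proj₂ (index (t j) (Tt j))
    inj : ∀ i j → idx i ≡ idx j → i ≡ j
    inj i j e with i Fin.≟ j
    ... | yes i≡j = i≡j
    ... | no i≢j  = ⊥-elim (t≉ i j i≢j (≋⇒≈ {t i} {t j} λ s →
      trans (t≋b i s) (trans (cong (λ n → pe s (b n)) e) (sym (t≋b j s)))))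
    zeroAt : ∀ a → evP k f a ≡ 0ℚ
    zeroAt a with extendInjective k idx inj a
    ... | A , K , hA with prescribe K A
    ... | s , hs = begin
      evP k f a            ≡⟨ evP-cong k f (λ j → sym (trans (t≋b j s) (trans (hs _ (proj₂ (hA j))) (proj₁ (hA j))))) ⟩
      evP k f (pe s ∘ t)   ≡⟨ pe-subst k f t s ⟨
      pe s (subst k f t)   ≡⟨ ≈⇒≋ {subst k f t} {const 0ℚ} f≈0 s ⟩
      0ℚ                   ∎

  Represented : ℕ → PExpr → Set
  Represented K q = Σ (Poly K) λ f → ∀ s → pe s q ≡ evP K f (λ i → pe s (b (toℕ i)))

  -- The bound `M` decreases while `K` is fixed, so that all intermediate results lie in the same
  -- polynomial ring.
  represent-below : ∀ K M → M ℕ.≤ K → ∀ q → OnlyOdd q → supp q ℕ.≤ 2 ℕ.* M → Represented K q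
  represent-below K M M≤K (const c) _ _ = constP K c , λ s → sym (evP-const K c _)
  represent-below K M M≤K (p ⊕ q) (op , oq) h
    with represent-below K M M≤K p op (ℕ.≤-trans (ℕ.m≤m⊔n (supp p) (supp q)) h)
       | represent-below K M M≤K q oq (ℕ.≤-trans (ℕ.m≤n⊔m (supp p) (supp q)) h)
  ... | f , ef | g , eg = addP K f g , λ s → trans (cong₂ _+_ (ef s) (eg s)) (sym (evP-add K f g _))
  represent-below K M M≤K (p ⊗ q) (op , oq) h
    with represent-below K M M≤K p op (ℕ.≤-trans (ℕ.m≤m⊔n (supp p) (supp q)) h)
       | represent-below K M M≤K q oq (ℕ.≤-trans (ℕ.m≤n⊔m (supp p) (supp q)) h)
  ... | f , ef | g , eg = mulP K f g , λ s → trans (cong₂ _*_ (ef s) (eg s)) (sym (evP-mul K f g _))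
  represent-below K (suc M) M<K (psum r) o h with even⇒2* r o
  ... | i , refl with ℕ.m≤n⇒m<n∨m≡n (ℕ.m<1+n⇒m≤n (ℕ.*-cancelˡ-< 2 i (suc M) h))
  ... | inj₁ i<M  = represent-below K M (ℕ.<⇒≤ M<K) (psum (2 ℕ.* i)) o (ℕ.*-monoʳ-< 2 i<M)
  -- For the top index, solve the triangular equation for p_{2i+1}: it is (b_i - rest_i) / c_i, and
  -- `rest i` has a smaller bound.
  ... | inj₂ refl with represent-below K i (ℕ.<⇒≤ M<K) (rest i) (odd i) (below i)
                     | divide (coeff i) (coeff≢0 i) 1ℚ
  ... | f , ef | c⁻¹ , ec = g , λ s → begin
      s (2 ℕ.* i)
        ≡⟨ *-identityˡ _ ⟨
      1ℚ * s (2 ℕ.* i)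
        ≡⟨ cong (_* s (2 ℕ.* i)) ec ⟨
      coeff i * c⁻¹ * s (2 ℕ.* i)
        ≡⟨ lem (coeff i) c⁻¹ (s (2 ℕ.* i)) (pe s (rest i)) ⟩
      c⁻¹ * ((coeff i * s (2 ℕ.* i) + pe s (rest i)) + - 1ℚ * pe s (rest i))
        ≡⟨ cong₂ (λ u v → c⁻¹ * (u + - 1ℚ * v)) (trans (sym (split i s)) (cong (λ n → pe s (b n)) (sym (Fin.toℕ-fromℕ< M<K)))) (ef s) ⟩
      _
        ≡⟨ eval-g (λ j → pe s (b (toℕ j))) ⟨
      evP K g (λ j → pe s (b (toℕ j))) ∎
    where
    lem : ∀ c d x r → c * d * x ≡ d * ((c * x + r) + - 1ℚ * r)
    lem = solve-∀ ringℚ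
    g : Poly K
    g = mulP K (constP K c⁻¹) (addP K (varP K (fromℕ< M<K)) (mulP K (constP K (- 1ℚ)) f))
    eval-g : ∀ a → evP K g a ≡ c⁻¹ * (a (fromℕ< M<K) + - 1ℚ * evP K f a)
    eval-g a = trans (evP-mul K (constP K c⁻¹) _ a) (cong₂ _*_ (evP-const K c⁻¹ a)
      (trans (evP-add K (varP K (fromℕ< M<K)) _ a) (cong₂ _+_ (evP-var K (fromℕ< M<K) a)
        (trans (evP-mul K (constP K (- 1ℚ)) f a) (cong (_* evP K f a) (evP-const K (- 1ℚ) a))))))

  represent : ∀ q → InΓ q → Σ ℕ λ K → Represented K q
  represent q (q′ , o , q≈q′) with represent-below (supp q′) (supp q′) ℕ.≤-refl q′ o (ℕ.m≤n*m (supp q′) 2)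
  ... | f , e = supp q′ , f , λ s → trans (≈⇒≋ {q} {q′} q≈q′ s) (e s)

  generates : ∀ (T : SymSet) → (∀ i → T (b i)) → (∀ y → T y → InΓ y) → GeneratesΓ T
  generates T Tb T⊆Γ = T⊆Γ , λ q q∈Γ → let (K , f , e) = represent q q∈Γ in
    K , b ∘ toℕ , (Tb ∘ toℕ) , f ,
    ≋⇒≈ {q} {subst K f (b ∘ toℕ)} λ s → trans (e s) (sym (pe-subst K f (b ∘ toℕ) s))

  -- Writing y as a polynomial in finitely many `b i` gives an algebraic relation. If y were
  -- different from all of these, the relation would contradict independence of T.
  maximal : ∀ (T : SymSet) → AlgIndep T → (∀ i → T (b i)) → ∀ y → T y → InΓ y →
    (∀ i → Dec (y ≋ b i)) → Σ ℕ λ i → y ≋ b i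
  maximal T indep Tb y Ty y∈Γ y≋b? with represent y y∈Γ
  ... | K , f , e with Fin.any? {n = K} (λ i → y≋b? (toℕ i))
  ... | yes (i , y≋b) = toℕ i , y≋b
  ... | no y≋̸b = ⊥-elim (constP-1≢0 K (All.head (All.tail (indep (suc K) t Tt t≉ g g≈0))))
    where
    t : Fin (suc K) → PExpr
    t zero    = y
    t (suc i) = b (toℕ i)
    Tt : ∀ i → T (t i)
    Tt zero    = Ty
    Tt (suc i) = Tb (toℕ i)
    t≉ : ∀ i j → i ≢ j → ¬ (t i ≈ t j)
    t≉ zero    zero    i≢j h = i≢j refl
    t≉ zero    (suc j) i≢j h = y≋̸b (j , ≈⇒≋ {y} {b (toℕ j)} h)
    t≉ (suc i) zero    i≢j h = y≋̸b (i , λ s → sym (≈⇒≋ {b (toℕ i)} {y} h s))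
    t≉ (suc i) (suc j) i≢j h =
      i≢j (cong suc (Fin.toℕ-injective (distinct _ _ (≈⇒≋ {b (toℕ i)} {b (toℕ j)} h))))
    -- This is the polynomial Y - f with Y as first variable; its coefficient 1 at Y shows that it
    -- is not zero.
    g : Poly (suc K)
    g = mulP K (constP K (- 1ℚ)) f ∷ constP K 1ℚ ∷ []
    lem : ∀ x → - 1ℚ * x + x * (1ℚ + x * 0ℚ) ≡ 0ℚ
    lem = solve-∀ ringℚ
    g≈0 : subst (suc K) g t ≈ const 0ℚ
    g≈0 = ≋⇒≈ {subst (suc K) g t} {const 0ℚ} λ s → trans (pe-subst (suc K) g t s) (trans
      (cong₂ (λ u v → u + pe s y * (v + pe s y * 0ℚ))
        (trans (evP-mul K (constP K (- 1ℚ)) f _)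
               (cong₂ _*_ (evP-const K (- 1ℚ) _) (sym (e s))))
        (evP-const K 1ℚ (λ i → pe s (b (toℕ i)))))
      (lem (pe s y)))

-- Chromatic symmetric functions as sums over vectors of colours

ind : Bool → ℚ
ind true  = 1ℚ
ind false = 0ℚ

ind-∧ : ∀ a b → ind (a ∧ b) ≡ ind a * ind b
ind-∧ true  b = sym (*-identityˡ _)
ind-∧ false b = sym (*-zeroˡ (ind b))

ind-not : ∀ b → ind (not b) ≡ 1ℚ + - 1ℚ * ind b
ind-not true  = refl
ind-not false = refl

sumVec : (m N : ℕ) → (Vec (Fin N) m → ℚ) → ℚ
sumVec zero    N F = F []
sumVec (suc m) N F = sumFin N (λ c → sumVec m N (λ κ → F (c ∷ κ)))

sumVec-cong : ∀ m N {F H : Vec (Fin N) m → ℚ} → (∀ κ → F κ ≡ H κ) → sumVec m N F ≡ sumVec m N H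
sumVec-cong zero    N e = e []
sumVec-cong (suc m) N e = sumFin-cong N (λ c → sumVec-cong m N (λ κ → e (c ∷ κ)))

sumVec-+ : ∀ m N (F H : Vec (Fin N) m → ℚ) → sumVec m N (λ κ → F κ + H κ) ≡ sumVec m N F + sumVec m N H
sumVec-+ zero    N F H = refl
sumVec-+ (suc m) N F H = trans (sumFin-cong N (λ c → sumVec-+ m N (λ κ → F (c ∷ κ)) (λ κ → H (c ∷ κ)))) (sumFin-+ N _ _)

sumVec-*ˡ : ∀ m N c (F : Vec (Fin N) m → ℚ) → sumVec m N (λ κ → c * F κ) ≡ c * sumVec m N F
sumVec-*ˡ zero    N c F = refl
sumVec-*ˡ (suc m) N c F = trans (sumFin-cong N (λ d → sumVec-*ˡ m N c (λ κ → F (d ∷ κ)))) (sumFin-*ˡ N c _)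

sumVec-sumFin : ∀ m N M (F : Fin M → Vec (Fin N) m → ℚ) →
  sumVec m N (λ κ → sumFin M (λ c → F c κ)) ≡ sumFin M (λ c → sumVec m N (F c))
sumVec-sumFin zero    N M F = refl
sumVec-sumFin (suc m) N M F = trans (sumFin-cong N (λ d → sumVec-sumFin m N M (λ c κ → F c (d ∷ κ))))
                                    (sumFin-swap N M _)

sumVec-insertAt : ∀ m N (j : Fin (suc m)) (F : Vec (Fin N) (suc m) → ℚ) →
  sumVec (suc m) N F ≡ sumFin N (λ c → sumVec m N (λ κ → F (insertAt κ j c)))
sumVec-insertAt m       N zero    F = refl
sumVec-insertAt (suc m) N (suc j) F =
  trans (sumFin-cong N (λ d → sumVec-insertAt m N j (λ κ → F (d ∷ κ)))) (sumFin-swap N N _)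

sumVec-prodFin : ∀ m N (g : Fin m → Fin N → ℚ) →
  sumVec m N (λ κ → prodFin m (λ u → g u (lookup κ u))) ≡ prodFin m (λ u → sumFin N (g u))
sumVec-prodFin zero    N g = refl
sumVec-prodFin (suc m) N g = trans
  (sumFin-cong N (λ c → trans (sumVec-*ˡ m N (g zero c) _) (cong (g zero c *_) (sumVec-prodFin m N (g ∘ suc)))))
  (sumFin-*ʳ N _ (g zero))

sumList-++ : ∀ xs ys → sumList (xs ++ ys) ≡ sumList xs + sumList ys
sumList-++ []       ys = sym (+-identityˡ _)
sumList-++ (x ∷ xs) ys = trans (cong (x +_) (sumList-++ xs ys)) (sym (+-assoc x _ _))

sumList-concatMap : ∀ {A B : Set} (F : B → ℚ) (h : A → List B) xs →
  sumList (map F (concatMap h xs)) ≡ sumList (map (λ x → sumList (map F (h x))) xs)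
sumList-concatMap F h []       = refl
sumList-concatMap F h (x ∷ xs) =
  trans (cong sumList (List.map-++ F (h x) (concatMap h xs)))
        (trans (sumList-++ (map F (h x)) _) (cong (sumList (map F (h x)) +_) (sumList-concatMap F h xs)))

sumList-tabulate : ∀ {A : Set} N (g : A → ℚ) (f : Fin N → A) → sumList (map g (tabulate f)) ≡ sumFin N (g ∘ f)
sumList-tabulate zero    g f = refl
sumList-tabulate (suc N) g f = cong (g (f zero) +_) (sumList-tabulate N g (f ∘ suc))

sumList-filter : ∀ {A : Set} (p : A → Bool) (W : A → ℚ) xs →
  sumList (map W (filterᵇ p xs)) ≡ sumList (map (λ x → W x * ind (p x)) xs)
sumList-filter p W []       = refl
sumList-filter p W (x ∷ xs) with p x
... | true  = cong₂ _+_ (sym (*-identityʳ (W x))) (sumList-filter p W xs)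
... | false = trans (sumList-filter p W xs) (trans (sym (+-identityˡ _)) (cong (_+ _) (sym (*-zeroʳ (W x)))))

-- The functions listed by `allFuns` agree with `lookup` of a vector only pointwise; this condition
-- lets a summand pass from one to the other.
Extensional : ∀ {n N} → ((Fin n → Fin N) → ℚ) → Set
Extensional F = ∀ κ κ′ → (∀ v → κ v ≡ κ′ v) → F κ ≡ F κ′

sumList-allFuns : ∀ n N (F : (Fin n → Fin N) → ℚ) → Extensional F →
  sumList (map F (allFuns n N)) ≡ sumVec n N (λ κ → F (lookup κ))
sumList-allFuns zero    N F ext = trans (+-identityʳ _) (ext _ _ λ ())
sumList-allFuns (suc n) N F ext = trans (sumList-concatMap F _ (allFin N)) (trans (sumList-tabulate N _ id)
  (sumFin-cong N λ c → trans (cong sumList (sym (List.map-∘ (allFuns n N))))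
    (trans (sumList-allFuns n N _ λ κ κ′ e → ext _ _ λ { zero → refl ; (suc v) → e v })
           (sumVec-cong n N λ κ → ext _ _ λ { zero → refl ; (suc v) → refl }))))

ind-allBool-++ : ∀ bs cs → ind (allBool (bs ++ cs)) ≡ ind (allBool bs) * ind (allBool cs)
ind-allBool-++ []       cs = sym (*-identityˡ _)
ind-allBool-++ (b ∷ bs) cs = begin
  ind (b ∧ allBool (bs ++ cs))                    ≡⟨ ind-∧ b _ ⟩
  ind b * ind (allBool (bs ++ cs))                ≡⟨ cong (ind b *_) (ind-allBool-++ bs cs) ⟩
  ind b * (ind (allBool bs) * ind (allBool cs))   ≡⟨ *-assoc (ind b) _ _ ⟨
  ind b * ind (allBool bs) * ind (allBool cs)     ≡⟨ cong (_* ind (allBool cs)) (ind-∧ b (allBool bs)) ⟨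
  ind (b ∧ allBool bs) * ind (allBool cs)         ∎

ind-allBool-concatMap : ∀ {A : Set} n (h : A → List Bool) (f : Fin n → A) →
  ind (allBool (concatMap h (tabulate f))) ≡ prodFin n (λ i → ind (allBool (h (f i))))
ind-allBool-concatMap zero    h f = refl
ind-allBool-concatMap (suc n) h f =
  trans (ind-allBool-++ (h (f zero)) _) (cong (ind (allBool (h (f zero))) *_) (ind-allBool-concatMap n h (f ∘ suc)))

ind-allBool-map : ∀ {A : Set} n (g : A → Bool) (f : Fin n → A) →
  ind (allBool (map g (tabulate f))) ≡ prodFin n (ind ∘ g ∘ f)
ind-allBool-map zero    g f = refl
ind-allBool-map (suc n) g f = trans (ind-∧ (g (f zero)) _) (cong (ind (g (f zero)) *_) (ind-allBool-map n g (f ∘ suc)))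

compatible : (G : Graph) {N : ℕ} → (Fin (Graph.n G) → Fin N) → Fin (Graph.n G) → Fin (Graph.n G) → Bool
compatible G κ i j = not (Graph.adj G i j ∧ (κ i == κ j))

ind-isProper : ∀ G {N} (κ : Fin (Graph.n G) → Fin N) →
  ind (isProper G κ) ≡ prodFin (Graph.n G) (λ i → prodFin (Graph.n G) (λ j → ind (compatible G κ i j)))
ind-isProper G κ = trans (ind-allBool-concatMap n _ id) (prodFin-cong n λ i → ind-allBool-map n (compatible G κ i) id)
  where n = Graph.n G

colourWeight : (G : Graph) (N : ℕ) → (Fin N → ℚ) → (Fin (Graph.n G) → Fin N) → ℚ
colourWeight G N ρ κ = prodFin n (λ v → ρ (κ v)) * prodFin n (λ i → prodFin n (λ j → ind (compatible G κ i j)))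
  where n = Graph.n G

chromEval≡sumVec : ∀ G N ρ → chromEval G N ρ ≡ sumVec (Graph.n G) N (λ κ → colourWeight G N ρ (lookup κ))
chromEval≡sumVec G N ρ = trans (sumList-filter (isProper G) _ (allFuns n N))
  (trans (cong sumList (List.map-cong (λ κ → cong (prodFin n (λ v → ρ (κ v)) *_) (ind-isProper G κ)) (allFuns n N)))
         (sumList-allFuns n N (colourWeight G N ρ) ext))
  where
  n = Graph.n G
  ext : Extensional (colourWeight G N ρ)
  ext κ κ′ e = cong₂ _*_ (prodFin-cong n (cong ρ ∘ e))
    (prodFin-cong n λ i → prodFin-cong n λ j → cong₂ (λ x y → ind (not (Graph.adj G i j ∧ (x == y)))) (e i) (e j))

==-suc : ∀ {N} (i j : Fin N) → (Fin.suc i == suc j) ≡ (i == j)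
==-suc i j with i Fin.≟ j
... | yes _ = refl
... | no _  = refl

==-refl : ∀ {N} (i : Fin N) → (i == i) ≡ true
==-refl zero    = refl
==-refl (suc i) = trans (==-suc i i) (==-refl i)

==-sym : ∀ {N} (i j : Fin N) → (i == j) ≡ (j == i)
==-sym zero    zero    = refl
==-sym zero    (suc j) = refl
==-sym (suc i) zero    = refl
==-sym (suc i) (suc j) = trans (==-suc i j) (trans (==-sym i j) (sym (==-suc j i)))

sumFin-δ : ∀ N (c : Fin N) (g : Fin N → ℚ) → sumFin N (λ d → ind (c == d) * g d) ≡ g c
sumFin-δ (suc N) zero    g = trans (cong₂ _+_ (*-identityˡ (g zero))
  (trans (sumFin-cong N (λ d → *-zeroˡ (g (suc d)))) (sumFin-0 N))) (+-identityʳ _)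
sumFin-δ (suc N) (suc c) g = trans (cong₂ _+_ (*-zeroˡ (g zero))
  (trans (sumFin-cong N (λ d → cong (λ b → ind b * g (suc d)) (==-suc c d))) (sumFin-δ N c (g ∘ suc)))) (+-identityˡ _)

sumFin-≢ : ∀ N (c : Fin N) (g : Fin N → ℚ) → sumFin N (λ d → ind (not (c == d)) * g d) ≡ sumFin N g + - 1ℚ * g c
sumFin-≢ N c g = begin
  sumFin N (λ d → ind (not (c == d)) * g d)
    ≡⟨ sumFin-cong N (λ d → trans (cong (_* g d) (ind-not (c == d))) (lem (ind (c == d)) (g d))) ⟩
  sumFin N (λ d → g d + - 1ℚ * (ind (c == d) * g d))
    ≡⟨ sumFin-+ N g _ ⟩
  sumFin N g + sumFin N (λ d → - 1ℚ * (ind (c == d) * g d))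
    ≡⟨ cong (sumFin N g +_) (trans (sumFin-*ˡ N (- 1ℚ) _) (cong (- 1ℚ *_) (sumFin-δ N c g))) ⟩
  sumFin N g + - 1ℚ * g c ∎
  where
  lem : ∀ e g → (1ℚ + - 1ℚ * e) * g ≡ g + - 1ℚ * (e * g)
  lem = solve-∀ ringℚ

ind-idem : ∀ b → ind b * ind b ≡ ind b
ind-idem true  = refl
ind-idem false = refl

-- Explicit chromatic symmetric functions

-- Represents the sum of x_c^{e+1} (p_1 - x_c)^k over all colours c.
starX : ℕ → ℕ → PExpr
starX zero    e = psum e
starX (suc k) e = (psum 0 ⊗ starX k e) ⊕ (const (- 1ℚ) ⊗ starX k (suc e))

eval-psum0 : ∀ N ρ → eval N ρ (psum 0) ≡ sumFin N ρ
eval-psum0 N ρ = sumFin-cong N (λ i → *-identityʳ (ρ i))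

eval-starX : ∀ N ρ k e → eval N ρ (starX k e) ≡
  sumFin N (λ c → qpow (ρ c) (suc e) * qpow (sumFin N ρ + - 1ℚ * ρ c) k)
eval-starX N ρ zero    e = sumFin-cong N (λ c → sym (*-identityʳ (qpow (ρ c) (suc e))))
eval-starX N ρ (suc k) e = begin
  eval N ρ (psum 0) * eval N ρ (starX k e) + - 1ℚ * eval N ρ (starX k (suc e))
    ≡⟨ cong₂ _+_ (cong₂ _*_ (eval-psum0 N ρ) (eval-starX N ρ k e)) (cong (- 1ℚ *_) (eval-starX N ρ k (suc e))) ⟩
  P * sumFin N (λ c → F c) + - 1ℚ * sumFin N (λ c → H c)
    ≡⟨ cong₂ _+_ (sumFin-*ˡ N P F) (sumFin-*ˡ N (- 1ℚ) H) ⟨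
  sumFin N (λ c → P * F c) + sumFin N (λ c → - 1ℚ * H c)
    ≡⟨ sumFin-+ N (λ c → P * F c) (λ c → - 1ℚ * H c) ⟨
  sumFin N (λ c → P * F c + - 1ℚ * H c)
    ≡⟨ sumFin-cong N (λ c → lem P (ρ c) (qpow (ρ c) e) (qpow (P + - 1ℚ * ρ c) k)) ⟩
  sumFin N (λ c → qpow (ρ c) (suc e) * qpow (P + - 1ℚ * ρ c) (suc k)) ∎
  where
  P = sumFin N ρ
  F H : Fin N → ℚ
  F c = qpow (ρ c) (suc e) * qpow (P + - 1ℚ * ρ c) k
  H c = qpow (ρ c) (suc (suc e)) * qpow (P + - 1ℚ * ρ c) k
  lem : ∀ P r x y → P * (r * x * y) + - 1ℚ * (r * (r * x) * y) ≡ r * x * ((P + - 1ℚ * r) * y)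
  lem = solve-∀ ringℚ

prodFin-const : ∀ m x → prodFin m (λ _ → x) ≡ qpow x m
prodFin-const zero    x = refl
prodFin-const (suc m) x = cong (x *_) (prodFin-const m x)

-- The four factors are the diagonal entry at `a`, the rest of its row, the rest of its column, and
-- the block avoiding `a`.
prodFin²-punchIn : ∀ m (a : Fin (suc m)) (o : Fin (suc m) → Fin (suc m) → ℚ) →
  prodFin (suc m) (λ i → prodFin (suc m) (o i)) ≡
  (o a a * prodFin m (λ u → o a (punchIn a u))) *
  (prodFin m (λ u → o (punchIn a u) a) * prodFin m (λ u → prodFin m (λ v → o (punchIn a u) (punchIn a v))))
prodFin²-punchIn m a o = trans (prodFin-punchIn m a (λ i → prodFin (suc m) (o i))) (cong₂ _*_ (prodFin-punchIn m a (o a))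
  (trans (prodFin-cong m (λ u → prodFin-punchIn m a (o (punchIn a u))))
    (prodFin-* m (λ u → o (punchIn a u) a) (λ u → prodFin m (λ v → o (punchIn a u) (punchIn a v))))))

-- Splitting off the colour of one vertex

module VertexRemoval (m : ℕ) (adj : Fin (suc m) → Fin (suc m) → Bool)
  (adj-sym : ∀ i j → adj i j ≡ adj j i) (adj-irrefl : ∀ i → adj i i ≡ false) (a : Fin (suc m)) where

  G : Graph
  G = record { n = suc m ; adj = adj ; sym = adj-sym ; irrefl = adj-irrefl }

  G∖a : Graph
  G∖a = record { n = m ; adj = λ i j → adj (punchIn a i) (punchIn a j)
               ; sym = λ i j → adj-sym (punchIn a i) (punchIn a j) ; irrefl = λ i → adj-irrefl (punchIn a i) }

  chromEval-split : ∀ N ρ → chromEval G N ρ ≡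
    sumFin N (λ c → ρ c * sumVec m N (λ κ →
      prodFin m (λ u → ind (not (adj a (punchIn a u) ∧ (c == lookup κ u)))) * colourWeight G∖a N ρ (lookup κ)))
  chromEval-split N ρ = trans (chromEval≡sumVec G N ρ) (trans (sumVec-insertAt m N a (λ κ → colourWeight G N ρ (lookup κ)))
    (sumFin-cong N λ c → trans (sumVec-cong m N (term c)) (sumVec-*ˡ m N (ρ c) (λ κ →
      prodFin m (λ u → ind (not (adj a (punchIn a u) ∧ (c == lookup κ u)))) * colourWeight G∖a N ρ (lookup κ)))))
    where
    term : ∀ c κ → colourWeight G N ρ (lookup (insertAt κ a c)) ≡
      ρ c * (prodFin m (λ u → ind (not (adj a (punchIn a u) ∧ (c == lookup κ u)))) * colourWeight G∖a N ρ (lookup κ))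
    term c κ = begin
      prodFin (suc m) (λ v → ρ (col v)) * prodFin (suc m) (λ i → prodFin (suc m) (o i))
        ≡⟨ cong₂ _*_ (prodFin-punchIn m a (λ v → ρ (col v))) (prodFin²-punchIn m a o) ⟩
      (ρ (col a) * prodFin m (λ u → ρ (col (punchIn a u)))) *
        ((o a a * prodFin m (λ u → o a (punchIn a u))) *
         (prodFin m (λ u → o (punchIn a u) a) * prodFin m (λ u → prodFin m (λ v → o (punchIn a u) (punchIn a v)))))
        ≡⟨ cong₂ _*_ (cong₂ _*_ (cong ρ at-a) (prodFin-cong m λ u → cong ρ (at u)))
             (cong₂ _*_ (cong₂ _*_ o-aa (prodFin-cong m o-a))
               (cong₂ _*_ (prodFin-cong m o-a′) (prodFin-cong m λ u → prodFin-cong m λ v →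
                 cong₂ (λ x y → ind (not (adj (punchIn a u) (punchIn a v) ∧ (x == y)))) (at u) (at v)))) ⟩
      (ρ c * R) * ((1ℚ * E) * (E * K))
        ≡⟨ lem (ρ c) R E K ⟩
      ρ c * ((E * E) * (R * K))
        -- Each edge at `a` is tested in both orders; the indicators are idempotent, so one test
        -- suffices.
        ≡⟨ cong (λ e → ρ c * (e * (R * K))) (trans (sym (prodFin-* m ε ε)) (prodFin-cong m λ u → ind-idem (not (adj a (punchIn a u) ∧ (c == lookup κ u))))) ⟩
      ρ c * (E * (R * K)) ∎
      where
      col : Fin (suc m) → Fin N
      col = lookup (insertAt κ a c)
      o : Fin (suc m) → Fin (suc m) → ℚ
      o i j = ind (compatible G col i j)
      R = prodFin m (λ u → ρ (lookup κ u))
      ε : Fin m → ℚ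
      ε u = ind (not (adj a (punchIn a u) ∧ (c == lookup κ u)))
      E = prodFin m ε
      K = prodFin m (λ i → prodFin m (λ j → ind (compatible G∖a (lookup κ) i j)))
      at-a : col a ≡ c
      at-a = Vec.insertAt-lookup κ a c
      at : ∀ u → col (punchIn a u) ≡ lookup κ u
      at = Vec.insertAt-punchIn κ a c
      o-aa : o a a ≡ 1ℚ
      o-aa = cong (λ b → ind (not (b ∧ (col a == col a)))) (adj-irrefl a)
      o-a : ∀ u → o a (punchIn a u) ≡ ind (not (adj a (punchIn a u) ∧ (c == lookup κ u)))
      o-a u = cong₂ (λ x y → ind (not (adj a (punchIn a u) ∧ (x == y)))) at-a (at u)
      o-a′ : ∀ u → o (punchIn a u) a ≡ ind (not (adj a (punchIn a u) ∧ (c == lookup κ u)))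
      o-a′ u = trans (cong₂ (λ p q → ind (not (p ∧ q))) (adj-sym (punchIn a u) a) (==-sym (col (punchIn a u)) (col a))) (o-a u)
      lem : ∀ r R E K → (r * R) * ((1ℚ * E) * (E * K)) ≡ r * ((E * E) * (R * K))
      lem = solve-∀ ringℚ

  module _ (edge : ∀ u → adj a (punchIn a u) ≡ true)
           (nonEdge : ∀ u v → adj (punchIn a u) (punchIn a v) ≡ false) where

    -- Once the centre has colour c, the remaining vertices are coloured independently, and each
    -- contributes p_1 - x_c.
    RepX-centre : RepX G (starX m 0)
    RepX-centre N ρ = trans (eval-starX N ρ m 0) (sym (trans (chromEval-split N ρ) (sumFin-cong N summand)))
      where
      summand : ∀ c → ρ c * sumVec m N (λ κ →
          prodFin m (λ u → ind (not (adj a (punchIn a u) ∧ (c == lookup κ u)))) * colourWeight G∖a N ρ (lookup κ))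
        ≡ qpow (ρ c) 1 * qpow (sumFin N ρ + - 1ℚ * ρ c) m
      summand c = cong₂ _*_ (sym (*-identityʳ (ρ c))) (begin
        _ ≡⟨ sumVec-cong m N (λ κ → trans (cong₂ _*_ (prodFin-cong m λ u → cong (λ b → ind (not (b ∧ (c == lookup κ u)))) (edge u))
               (trans (cong (prodFin m (λ u → ρ (lookup κ u)) *_) (trans (prodFin-cong m λ i → trans (prodFin-cong m λ j →
                 cong (λ b → ind (not (b ∧ (lookup κ i == lookup κ j)))) (nonEdge i j)) (prodFin-1 m)) (prodFin-1 m))) (*-identityʳ (prodFin m (λ u → ρ (lookup κ u))))))
               (sym (prodFin-* m (λ u → ind (not (c == lookup κ u))) (λ u → ρ (lookup κ u))))) ⟩
        sumVec m N (λ κ → prodFin m (λ u → ind (not (c == lookup κ u)) * ρ (lookup κ u)))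
          ≡⟨ sumVec-prodFin m N (λ _ d → ind (not (c == d)) * ρ d) ⟩
        prodFin m (λ _ → sumFin N (λ d → ind (not (c == d)) * ρ d))
          ≡⟨ prodFin-cong m (λ _ → sumFin-≢ N c ρ) ⟩
        prodFin m (λ _ → sumFin N ρ + - 1ℚ * ρ c)
          ≡⟨ prodFin-const m (sumFin N ρ + - 1ℚ * ρ c) ⟩
        qpow (sumFin N ρ + - 1ℚ * ρ c) m ∎)

  module _ (isolated : ∀ u → adj a (punchIn a u) ≡ false) where

    RepX-isolated : ∀ x → RepX G∖a x → RepX G (psum 0 ⊗ x)
    RepX-isolated x rep N ρ = sym (begin
      chromEval G N ρ
        ≡⟨ chromEval-split N ρ ⟩
      _ ≡⟨ sumFin-cong N (λ c → cong (ρ c *_) (sumVec-cong m N λ κ → trans (cong (_* colourWeight G∖a N ρ (lookup κ))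
             (trans (prodFin-cong m λ u → cong (λ b → ind (not (b ∧ (c == lookup κ u)))) (isolated u)) (prodFin-1 m)))
             (*-identityˡ (colourWeight G∖a N ρ (lookup κ))))) ⟩
      sumFin N (λ c → ρ c * sumVec m N (λ κ → colourWeight G∖a N ρ (lookup κ)))
        ≡⟨ sumFin-*ʳ N (sumVec m N (λ κ → colourWeight G∖a N ρ (lookup κ))) ρ ⟩
      sumFin N ρ * sumVec m N (λ κ → colourWeight G∖a N ρ (lookup κ))
        ≡⟨ cong₂ _*_ (sym (eval-psum0 N ρ)) (trans (sym (chromEval≡sumVec G∖a N ρ)) (sym (rep N ρ))) ⟩
      eval N ρ (psum 0 ⊗ x) ∎)

RepX-star : ∀ k → RepX (star k) (starX k 0)
RepX-star k = VertexRemoval.RepX-centre k (Graph.adj (star k)) (Graph.sym (star k)) (Graph.irrefl (star k)) zero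
  (λ _ → refl) (λ _ _ → refl)

RepX-resp-adj : ∀ G {adj′ s′ i′} → (∀ u v → Graph.adj G u v ≡ adj′ u v) → ∀ x → RepX G x →
  RepX (record { n = Graph.n G ; adj = adj′ ; sym = s′ ; irrefl = i′ }) x
RepX-resp-adj G {adj′} {s′} {i′} e x rep N ρ = trans (rep N ρ) (trans (chromEval≡sumVec G N ρ) (trans
  (sumVec-cong n N λ κ → cong (prodFin n (λ v → ρ (lookup κ v)) *_) (prodFin-cong n λ u → prodFin-cong n λ v →
    cong (λ b → ind (not (b ∧ (lookup κ u == lookup κ v)))) (e u v)))
  (sym (chromEval≡sumVec (record { n = n ; adj = adj′ ; sym = s′ ; irrefl = i′ }) N ρ))))
  where n = Graph.n G

-- This is p_1³ - 3 p_1 p_2 + 2 p_3, that is 6 e_3, with multiples written as repeated sums.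
triangleX : PExpr
triangleX = (psum 0 ⊗ (psum 0 ⊗ psum 0)) ⊕
  ((const (- 1ℚ) ⊗ ((psum 0 ⊗ psum 1) ⊕ ((psum 0 ⊗ psum 1) ⊕ (psum 0 ⊗ psum 1)))) ⊕ (psum 2 ⊕ psum 2))

RepX-C3 : RepX C3 triangleX
RepX-C3 N ρ = sym (trans (chromEval≡sumVec C3 N ρ) (begin
  sumFin N (λ a → sumFin N (λ b → sumFin N (λ c → colourWeight C3 N ρ (lookup (a ∷ b ∷ c ∷ [])))))
    ≡⟨ sumFin-cong N (λ a → sumFin-cong N λ b → sumFin-cong N λ c → term a b c) ⟩
  sumFin N (λ a → sumFin N (λ b → sumFin N (λ c → (e a b * (ρ a * ρ b)) * (e a c * (e b c * ρ c)))))
    -- Colours are summed from the inside out. The factor `e a b` keeps the two excluded colours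
    -- distinct, so the innermost sum becomes p_1 - x_a - x_b.
    ≡⟨ sumFin-cong N (λ a → sumFin-cong N (λ b → trans (sumFin-*ˡ N (e a b * (ρ a * ρ b)) (λ c → e a c * (e b c * ρ c))) (third a b))) ⟩
  sumFin N (λ a → sumFin N (λ b → ρ a * (e a b * h a b)))
    ≡⟨ sumFin-cong N (λ a → trans (sumFin-*ˡ N (ρ a) (λ b → e a b * h a b)) (cong (ρ a *_) (sumFin-≢ N a (h a)))) ⟩
  sumFin N (λ a → ρ a * (sumFin N (h a) + - 1ℚ * h a a))
    ≡⟨ sumFin-cong N (λ a → trans (cong (λ z → ρ a * (z + - 1ℚ * h a a)) (sum-h a)) (second P (p 1) (ρ a))) ⟩
  sumFin N (λ a → K * qpow (ρ a) 1 + (L * qpow (ρ a) 2 + (1ℚ + 1ℚ) * qpow (ρ a) 3))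
    ≡⟨ trans (sumFin-+ N (λ a → K * m 0 a) (λ a → L * m 1 a + (1ℚ + 1ℚ) * m 2 a)) (cong₂ _+_ (sumFin-*ˡ N K (m 0))
         (trans (sumFin-+ N (λ a → L * m 1 a) (λ a → (1ℚ + 1ℚ) * m 2 a))
           (cong₂ _+_ (sumFin-*ˡ N L (m 1)) (sumFin-*ˡ N (1ℚ + 1ℚ) (m 2))))) ⟩
  K * p 0 + (L * p 1 + (1ℚ + 1ℚ) * p 2)
    ≡⟨ first (p 0) (p 1) (p 2) ⟩
  eval N ρ triangleX ∎))
  where
  e : Fin N → Fin N → ℚ
  e a b = ind (not (a == b))
  e-sym : ∀ a b → e a b ≡ e b a
  e-sym a b = cong (λ z → ind (not z)) (==-sym a b)
  p : ℕ → ℚ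
  p = mom N ρ
  m : ℕ → Fin N → ℚ
  m r a = qpow (ρ a) (suc r)
  P = p 0
  K = P * P + - 1ℚ * p 1
  L = - 1ℚ * (P + P)
  h : Fin N → Fin N → ℚ
  h a b = ρ b * (P + - 1ℚ * ρ b + - 1ℚ * ρ a)
  split : ∀ r s t u v w → (r * (s * (t * 1ℚ))) * ((1ℚ * (u * (v * 1ℚ))) * ((u * (1ℚ * (w * 1ℚ))) * ((v * (w * (1ℚ * 1ℚ))) * 1ℚ)))
    ≡ ((u * u) * (r * s)) * ((v * v) * ((w * w) * t))
  split = solve-∀ ringℚ
  term : ∀ a b c → colourWeight C3 N ρ (lookup (a ∷ b ∷ c ∷ [])) ≡ (e a b * (ρ a * ρ b)) * (e a c * (e b c * ρ c))
  term a b c rewrite ==-sym b a | ==-sym c a | ==-sym c b = trans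
    (split (ρ a) (ρ b) (ρ c) (e a b) (e a c) (e b c))
    (cong₂ _*_ (cong (_* (ρ a * ρ b)) (ind-idem (not (a == b))))
      (cong₂ (λ x y → x * (y * ρ c)) (ind-idem (not (a == c))) (ind-idem (not (b == c)))))
  third : ∀ a b → (e a b * (ρ a * ρ b)) * sumFin N (λ c → e a c * (e b c * ρ c)) ≡ ρ a * (e a b * h a b)
  third a b = begin
    (e a b * (ρ a * ρ b)) * sumFin N (λ c → e a c * (e b c * ρ c))
      ≡⟨ cong ((e a b * (ρ a * ρ b)) *_) (trans (sumFin-≢ N a (λ c → e b c * ρ c))
           (cong₂ (λ x y → x + - 1ℚ * (y * ρ a)) (trans (sumFin-≢ N b ρ) (cong (_+ - 1ℚ * ρ b) (sym (eval-psum0 N ρ)))) (e-sym b a))) ⟩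
    (e a b * (ρ a * ρ b)) * ((P + - 1ℚ * ρ b) + - 1ℚ * (e a b * ρ a))
      ≡⟨ lem₁ (e a b) (ρ a) (ρ b) P ⟩
    ρ a * (e a b * (ρ b * (P + - 1ℚ * ρ b)) + - 1ℚ * ((e a b * e a b) * (ρ b * ρ a)))
      ≡⟨ cong (λ z → ρ a * (e a b * (ρ b * (P + - 1ℚ * ρ b)) + - 1ℚ * (z * (ρ b * ρ a)))) (ind-idem (not (a == b))) ⟩
    ρ a * (e a b * (ρ b * (P + - 1ℚ * ρ b)) + - 1ℚ * (e a b * (ρ b * ρ a)))
      ≡⟨ lem₂ (e a b) (ρ a) (ρ b) P ⟩
    ρ a * (e a b * h a b) ∎
    where
    lem₁ : ∀ e r s P → (e * (r * s)) * ((P + - 1ℚ * s) + - 1ℚ * (e * r)) ≡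
      r * (e * (s * (P + - 1ℚ * s)) + - 1ℚ * ((e * e) * (s * r)))
    lem₁ = solve-∀ ringℚ
    lem₂ : ∀ e r s P → r * (e * (s * (P + - 1ℚ * s)) + - 1ℚ * (e * (s * r))) ≡
      r * (e * (s * (P + - 1ℚ * s + - 1ℚ * r)))
    lem₂ = solve-∀ ringℚ
  sum-h : ∀ a → sumFin N (h a) ≡ P * (P + - 1ℚ * ρ a) + - 1ℚ * p 1
  sum-h a = trans (sumFin-cong N λ b → lem (ρ b) P (ρ a)) (trans (sumFin-+ N (λ b → qpow (ρ b) 1 * (P + - 1ℚ * ρ a)) (λ b → - 1ℚ * qpow (ρ b) 2))
    (cong₂ _+_ (sumFin-*ʳ N (P + - 1ℚ * ρ a) (λ b → qpow (ρ b) 1)) (sumFin-*ˡ N (- 1ℚ) (λ b → qpow (ρ b) 2))))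
    where
    lem : ∀ s P r → s * (P + - 1ℚ * s + - 1ℚ * r) ≡ (s * 1ℚ) * (P + - 1ℚ * r) + - 1ℚ * (s * (s * 1ℚ))
    lem = solve-∀ ringℚ
  second : ∀ P q r → r * ((P * (P + - 1ℚ * r) + - 1ℚ * q) + - 1ℚ * (r * (P + - 1ℚ * r + - 1ℚ * r))) ≡
    (P * P + - 1ℚ * q) * (r * 1ℚ) + ((- 1ℚ * (P + P)) * (r * (r * 1ℚ)) + (1ℚ + 1ℚ) * (r * (r * (r * 1ℚ))))
  second = solve-∀ ringℚ
  first : ∀ p q r → (p * p + - 1ℚ * q) * p + ((- 1ℚ * (p + p)) * q + (1ℚ + 1ℚ) * r) ≡
    p * (p * p) + (- 1ℚ * (p * q + (p * q + p * q)) + (r + r))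
  first = solve-∀ ringℚ

-- Deletion–contraction

prodFin-scaleAt : ∀ m (i : Fin m) k (f g : Fin m → ℚ) → f i ≡ k * g i → (∀ u → u ≢ i → f u ≡ g u) →
  prodFin m f ≡ k * prodFin m g
prodFin-scaleAt (suc m) zero    k f g e off =
  trans (cong₂ _*_ e (prodFin-cong m λ u → off (suc u) λ ())) (*-assoc k (g zero) _)
prodFin-scaleAt (suc m) (suc i) k f g e off = trans
  (cong₂ _*_ (off zero λ ()) (prodFin-scaleAt m i k (f ∘ suc) (g ∘ suc) e λ u u≢i → off (suc u) (u≢i ∘ Fin.suc-injective)))
  (lem (g zero) k _)
  where
  lem : ∀ a k p → a * (k * p) ≡ k * (a * p)
  lem = solve-∀ ringℚ

prodFin-absorb : ∀ n (i : Fin n) (f : Fin n → ℚ) c → f i * c ≡ f i → prodFin n f * c ≡ prodFin n f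
prodFin-absorb (suc n) zero    f c e = trans (lem (f zero) _ c) (cong (_* prodFin n (f ∘ suc)) e)
  where
  lem : ∀ a p c → a * p * c ≡ a * c * p
  lem = solve-∀ ringℚ
prodFin-absorb (suc n) (suc i) f c e =
  trans (*-assoc (f zero) _ c) (cong (f zero *_) (prodFin-absorb n i (f ∘ suc) c e))

module Merge {m : ℕ} (i j : Fin (suc m)) (i≢j : i ≢ j) where

  i′ : Fin m
  i′ = punchOut (i≢j ∘ sym)

  merge : Fin (suc m) → Fin m
  merge v with j Fin.≟ v
  ... | yes _  = i′
  ... | no j≢v = punchOut j≢v

  -- Weights are class sizes minus one, so uniting classes adds the weights and one more.
  mergeWeight : (Fin (suc m) → ℕ) → Fin m → ℕ
  mergeWeight w u with u Fin.≟ i′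
  ... | yes _ = w i ℕ.+ suc (w j)
  ... | no _  = w (punchIn j u)

  lookup-merge : ∀ {N} (κ : Vec (Fin N) m) v → lookup (insertAt κ j (lookup κ i′)) v ≡ lookup κ (merge v)
  lookup-merge κ v with j Fin.≟ v
  ... | yes refl = Vec.insertAt-lookup κ j (lookup κ i′)
  ... | no j≢v   = trans (cong (lookup (insertAt κ j (lookup κ i′))) (sym (Fin.punchIn-punchOut j≢v)))
                         (Vec.insertAt-punchIn κ j (lookup κ i′) (punchOut j≢v))

  punchIn-merge : ∀ v → v ≢ j → punchIn j (merge v) ≡ v
  punchIn-merge v v≢j with j Fin.≟ v
  ... | yes j≡v = ⊥-elim (v≢j (sym j≡v))
  ... | no j≢v  = Fin.punchIn-punchOut j≢v

  merge-injective : ∀ v v′ → v ≢ j → v′ ≢ j → merge v ≡ merge v′ → v ≡ v′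
  merge-injective v v′ v≢j v′≢j e =
    trans (sym (punchIn-merge v v≢j)) (trans (cong (punchIn j) e) (punchIn-merge v′ v′≢j))

  mergeWeight-off : ∀ w v → v ≢ i → v ≢ j → mergeWeight w (merge v) ≡ w v
  mergeWeight-off w v v≢i v≢j with merge v Fin.≟ i′
  ... | yes e = ⊥-elim (v≢i (trans (sym (punchIn-merge v v≢j))
                  (trans (cong (punchIn j) e) (Fin.punchIn-punchOut (i≢j ∘ sym)))))
  ... | no _  = cong w (punchIn-merge v v≢j)

  -- Only the factor at `i′` changes. This one rule is applied to the colour weights, to the signs
  -- of ω and to the values of power sums.
  prodFin-mergeWeight : ∀ w (g : Fin m → ℕ → ℚ) k → g i′ (w i ℕ.+ suc (w j)) ≡ k * g i′ (w i) →
    prodFin m (λ u → g u (mergeWeight w u)) ≡ k * prodFin m (λ u → g u (w (punchIn j u)))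
  prodFin-mergeWeight w g k e = prodFin-scaleAt m i′ k _ _ at off
    where
    at : g i′ (mergeWeight w i′) ≡ k * g i′ (w (punchIn j i′))
    at with i′ Fin.≟ i′
    ... | yes _   = trans e (cong (λ v → k * g i′ (w v)) (sym (Fin.punchIn-punchOut (i≢j ∘ sym))))
    ... | no i′≢i′ = ⊥-elim (i′≢i′ refl)
    off : ∀ u → u ≢ i′ → g u (mergeWeight w u) ≡ g u (w (punchIn j u))
    off u u≢i′ with u Fin.≟ i′
    ... | yes u≡i′ = ⊥-elim (u≢i′ u≡i′)
    ... | no _     = refl

prodPsum : ∀ m → (Fin m → ℕ) → PExpr
prodPsum zero    w = const 1ℚ
prodPsum (suc m) w = psum (w zero) ⊗ prodPsum m (w ∘ suc)

pe-prodPsum : ∀ m w s → pe s (prodPsum m w) ≡ prodFin m (s ∘ w)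
pe-prodPsum zero    w s = refl
pe-prodPsum (suc m) w s = cong (s (w zero) *_) (pe-prodPsum m (w ∘ suc) s)

module DeletionContraction (n : ℕ) (adj : Fin n → Fin n → Bool) where

  -- A quotient φ of the vertex set; the class u consists of suc (w u) vertices.
  record State : Set where
    constructor state
    field
      m : ℕ
      w : Fin m → ℕ
      φ : Fin n → Fin m
  open State

  Pairs : Set
  Pairs = List (Fin n × Fin n)

  contract : (S : State) (i j : Fin (m S)) → i ≢ j → State
  contract (state (suc m) w φ) i j i≢j = state m (mergeWeight w) (merge ∘ φ)
    where open Merge i j i≢j

  -- The list may contain non-edges and repetitions, which leaves the order of treating the edges
  -- free. The decision is a separate argument of `expandEdge` so that proofs can select its branch.
  expand : Pairs → State → PExpr
  expandEdge : (L : Pairs) (S : State) (i j : Fin (m S)) → Dec (i ≡ j) → PExpr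
  expand []            S = prodPsum (m S) (w S)
  expand ((a , b) ∷ L) S = if adj a b then expandEdge L S (φ S a) (φ S b) (φ S a Fin.≟ φ S b) else expand L S
  expandEdge L S i j (yes _)  = const 0ℚ
  expandEdge L S i j (no i≢j) = expand L S ⊕ (const (- 1ℚ) ⊗ expand L (contract S i j i≢j))

  ok : ∀ {N} → (Fin n → Fin N) → Fin n × Fin n → Bool
  ok κ (a , b) = not (adj a b ∧ (κ a == κ b))

  weight : ∀ S {N} → (Fin N → ℚ) → Vec (Fin N) (m S) → ℚ
  weight S ρ κ = prodFin (m S) (λ u → qpow (ρ (lookup κ u)) (suc (w S u)))

  allOk : Pairs → ∀ S {N} → Vec (Fin N) (m S) → ℚ
  allOk L S κ = ind (allBool (map (ok (λ v → lookup κ (φ S v))) L))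

  colourings : Pairs → State → (N : ℕ) → (Fin N → ℚ) → ℚ
  colourings L S N ρ = sumVec (m S) N (λ κ → weight S ρ κ * allOk L S κ)

  sumVec-monochromatic : ∀ {m N} (i j : Fin (suc m)) (i≢j : i ≢ j) (F : Vec (Fin N) (suc m) → ℚ) →
    sumVec (suc m) N (λ κ → ind (lookup κ i == lookup κ j) * F κ) ≡
    sumVec m N (λ κ → F (insertAt κ j (lookup κ (Merge.i′ i j i≢j))))
  sumVec-monochromatic {m} {N} i j i≢j F = begin
    sumVec (suc m) N (λ κ → ind (lookup κ i == lookup κ j) * F κ)
      ≡⟨ sumVec-insertAt m N j (λ κ → ind (lookup κ i == lookup κ j) * F κ) ⟩
    sumFin N (λ c → sumVec m N (λ κ → ind (lookup (insertAt κ j c) i == lookup (insertAt κ j c) j) * F (insertAt κ j c)))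
      ≡⟨ sumFin-cong N (λ c → sumVec-cong m N λ κ → cong₂ (λ x y → ind (x == y) * F (insertAt κ j c)) (at-i κ c) (Vec.insertAt-lookup κ j c)) ⟩
    sumFin N (λ c → sumVec m N (λ κ → ind (lookup κ i′ == c) * F (insertAt κ j c)))
      ≡⟨ sumVec-sumFin m N N (λ c κ → ind (lookup κ i′ == c) * F (insertAt κ j c)) ⟨
    sumVec m N (λ κ → sumFin N (λ c → ind (lookup κ i′ == c) * F (insertAt κ j c)))
      ≡⟨ sumVec-cong m N (λ κ → sumFin-δ N (lookup κ i′) (λ c → F (insertAt κ j c))) ⟩
    sumVec m N (λ κ → F (insertAt κ j (lookup κ i′))) ∎
    where
    open Merge i j i≢j using (i′)
    at-i : ∀ κ c → lookup (insertAt κ j c) i ≡ lookup κ i′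
    at-i κ c = trans (cong (lookup (insertAt κ j c)) (sym (Fin.punchIn-punchOut (i≢j ∘ sym)))) (Vec.insertAt-punchIn κ j c i′)

  contract-term : ∀ L m w φ i j i≢j {N} (ρ : Fin N → ℚ) κ →
    let S = state (suc m) w φ ; κ⁺ = insertAt κ j (lookup κ (Merge.i′ i j i≢j)) in
    weight S ρ κ⁺ * allOk L S κ⁺ ≡ weight (contract S i j i≢j) ρ κ * allOk L (contract S i j i≢j) κ
  contract-term L m w φ i j i≢j {N} ρ κ = cong₂ _*_ weights
    (cong (ind ∘ allBool) (List.map-cong (λ (a , b) → cong₂ (λ x y → not (adj a b ∧ (x == y)))
      (lookup-merge κ (φ a)) (lookup-merge κ (φ b))) L))
    where
    open Merge i j i≢j
    κ⁺ : Vec (Fin N) (suc m)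
    κ⁺ = insertAt κ j (lookup κ i′)
    x : Fin N → ℕ → ℚ
    x c e = qpow (ρ c) (suc e)
    pow : ∀ r a b → qpow r (suc (a ℕ.+ suc b)) ≡ qpow r (suc b) * qpow r (suc a)
    pow r a b = trans (qpow-+ r (suc a) (suc b)) (*-comm (qpow r (suc a)) (qpow r (suc b)))
    weights : prodFin (suc m) (λ u → x (lookup κ⁺ u) (w u)) ≡ prodFin m (λ u → x (lookup κ u) (mergeWeight w u))
    weights = begin
      prodFin (suc m) (λ u → x (lookup κ⁺ u) (w u))
        ≡⟨ prodFin-punchIn m j (λ u → x (lookup κ⁺ u) (w u)) ⟩
      x (lookup κ⁺ j) (w j) * prodFin m (λ u → x (lookup κ⁺ (punchIn j u)) (w (punchIn j u)))
        ≡⟨ cong₂ _*_ (cong (λ c → x c (w j)) (Vec.insertAt-lookup κ j _))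
             (prodFin-cong m λ u → cong (λ c → x c (w (punchIn j u))) (Vec.insertAt-punchIn κ j _ u)) ⟩
      x (lookup κ i′) (w j) * prodFin m (λ u → x (lookup κ u) (w (punchIn j u)))
        ≡⟨ prodFin-mergeWeight w (λ u e → x (lookup κ u) e) (x (lookup κ i′) (w j)) (pow (ρ (lookup κ i′)) (w i) (w j)) ⟨
      prodFin m (λ u → x (lookup κ u) (mergeWeight w u)) ∎

  eval-expand : ∀ L S N ρ → eval N ρ (expand L S) ≡ colourings L S N ρ
  eval-expandEdge : ∀ L S i j (d : Dec (i ≡ j)) N ρ → eval N ρ (expandEdge L S i j d) ≡
    sumVec (m S) N (λ κ → weight S ρ κ * (ind (not (lookup κ i == lookup κ j)) * allOk L S κ))
  eval-expand [] (state m w φ) N ρ = sym (trans (sumVec-cong m N λ κ → *-identityʳ (weight (state m w φ) ρ κ))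
    (trans (sumVec-prodFin m N (λ u c → qpow (ρ c) (suc (w u)))) (sym (eval-prodPsum m w))))
    where
    eval-prodPsum : ∀ m w → eval N ρ (prodPsum m w) ≡ prodFin m (λ u → sumFin N (λ c → qpow (ρ c) (suc (w u))))
    eval-prodPsum zero    w = refl
    eval-prodPsum (suc m) w = cong (eval N ρ (psum (w zero)) *_) (eval-prodPsum m (w ∘ suc))
  eval-expand ((a , b) ∷ L) S N ρ with adj a b
  ... | false = trans (eval-expand L S N ρ) refl
  ... | true  = trans (eval-expandEdge L S (φ S a) (φ S b) (φ S a Fin.≟ φ S b) N ρ)
    (sumVec-cong (m S) N λ κ → cong (weight S ρ κ *_) (sym (ind-∧ (not (lookup κ (φ S a) == lookup κ (φ S b))) _)))
  eval-expandEdge L S i j (yes refl) N ρ = sym (trans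
    (sumVec-cong (m S) N λ κ → trans (cong (λ z → weight S ρ κ * (ind (not z) * allOk L S κ)) (==-refl (lookup κ i)))
      (lem (weight S ρ κ) (allOk L S κ)))
    (trans (sumVec-*ˡ (m S) N 0ℚ (weight S ρ)) (*-zeroˡ (sumVec (m S) N (weight S ρ)))))
    where
    lem : ∀ x y → x * (0ℚ * y) ≡ 0ℚ * x
    lem = solve-∀ ringℚ
  eval-expandEdge L S@(state (suc m) w φ) i j (no i≢j) N ρ = sym (begin
    sumVec (suc m) N (λ κ → weight S ρ κ * (ind (not (lookup κ i == lookup κ j)) * allOk L S κ))
      -- Replacing "different" by 1 minus "equal" separates the deletion term from the contraction
      -- term.
      ≡⟨ sumVec-cong (suc m) N (λ κ → trans (cong (λ z → weight S ρ κ * (z * allOk L S κ)) (ind-not (lookup κ i == lookup κ j)))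
           (lem (weight S ρ κ) (ind (lookup κ i == lookup κ j)) (allOk L S κ))) ⟩
    sumVec (suc m) N (λ κ → F κ + - 1ℚ * (ind (lookup κ i == lookup κ j) * F κ))
      ≡⟨ sumVec-+ (suc m) N F (λ κ → - 1ℚ * (ind (lookup κ i == lookup κ j) * F κ)) ⟩
    sumVec (suc m) N F + sumVec (suc m) N (λ κ → - 1ℚ * (ind (lookup κ i == lookup κ j) * F κ))
      ≡⟨ cong₂ _+_ (sym (eval-expand L S N ρ)) (trans (sumVec-*ˡ (suc m) N (- 1ℚ) (λ κ → ind (lookup κ i == lookup κ j) * F κ))
           (cong (- 1ℚ *_) (trans (sumVec-monochromatic i j i≢j F)
             (trans (sumVec-cong m N (contract-term L m w φ i j i≢j ρ)) (sym (eval-expand L (contract S i j i≢j) N ρ)))))) ⟩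
    eval N ρ (expand L S) + - 1ℚ * eval N ρ (expand L (contract S i j i≢j)) ∎)
    where
    F : Vec (Fin N) (suc m) → ℚ
    F κ = weight S ρ κ * allOk L S κ
    lem : ∀ x e y → x * ((1ℚ + - 1ℚ * e) * y) ≡ x * y + - 1ℚ * (e * (x * y))
    lem = solve-∀ ringℚ

  discrete : State
  discrete = state n (λ _ → 0) id

-- Signs of ω and positivity in the deletion-contraction expansion

sgn-suc : ∀ r → sgn (suc r) ≡ - 1ℚ * sgn r
sgn-suc r with even r
... | true  = refl
... | false = refl

sgn-square : ∀ r → sgn r * sgn r ≡ 1ℚ
sgn-square r with even r
... | true  = refl
... | false = refl

-- ω acts on p_{r+1} by (-1)^r. Classes of sizes a + 1 and b + 1 unite to size a + b + 2, so the new
-- exponent a + b + 1 exceeds the sum of the old ones by one.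
sgn-+suc : ∀ a b → sgn (a ℕ.+ suc b) ≡ (- 1ℚ * sgn b) * sgn a
sgn-+suc zero    b = trans (sgn-suc b) (sym (*-identityʳ (- 1ℚ * sgn b)))
sgn-+suc (suc a) b = trans (sgn-suc (a ℕ.+ suc b)) (trans (cong (- 1ℚ *_) (sgn-+suc a b))
  (trans (lem (- 1ℚ * sgn b) (sgn a)) (cong ((- 1ℚ * sgn b) *_) (sym (sgn-suc a)))))
  where
  lem : ∀ x y → - 1ℚ * (x * y) ≡ x * (- 1ℚ * y)
  lem = solve-∀ ringℚ

prodFin-nonneg : ∀ m (f : Fin m → ℚ) → (∀ u → 0ℚ ≤ f u) → 0ℚ ≤ prodFin m f
prodFin-nonneg zero    f h = nonNegative⁻¹ 1ℚ
prodFin-nonneg (suc m) f h = *-nonneg (h zero) (prodFin-nonneg m (f ∘ suc) (h ∘ suc))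
  where
  *-nonneg : ∀ {x y} → 0ℚ ≤ x → 0ℚ ≤ y → 0ℚ ≤ x * y
  *-nonneg {x} {y} 0≤x 0≤y = nonNegative⁻¹ (x * y) {{nonNeg*nonNeg⇒nonNeg x {{nonNegative 0≤x}} y {{nonNegative 0≤y}}}}

module SignedBounds (n : ℕ) (adj : Fin n → Fin n → Bool) (s : ℕ → ℚ) (0≤s : ∀ r → 0ℚ ≤ s r) where
  open DeletionContraction n adj
  open State

  -- The sign by which ω acts on the product of the power sums belonging to the classes of `S`.
  σ : State → ℚ
  σ S = prodFin (m S) (sgn ∘ w S)

  σ-contract : ∀ S i j i≢j → σ (contract S i j i≢j) ≡ - 1ℚ * σ S
  σ-contract (state (suc m) w φ) i j i≢j = begin
    prodFin m (sgn ∘ mergeWeight w)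
      ≡⟨ prodFin-mergeWeight w (λ _ → sgn) (- 1ℚ * sgn (w j)) (sgn-+suc (w i) (w j)) ⟩
    - 1ℚ * sgn (w j) * prodFin m (λ u → sgn (w (punchIn j u)))
      ≡⟨ *-assoc (- 1ℚ) (sgn (w j)) _ ⟩
    - 1ℚ * (sgn (w j) * prodFin m (λ u → sgn (w (punchIn j u))))
      ≡⟨ cong (- 1ℚ *_) (prodFin-punchIn m j (sgn ∘ w)) ⟨
    - 1ℚ * prodFin (suc m) (sgn ∘ w) ∎
    where open Merge i j i≢j

  -- Each contraction changes both the sign in the deletion–contraction recursion and the sign of ω,
  -- so the terms fixed by ω (sum P) all enter positively and the others (sum Q) negatively.
  record Bounds (S : State) (x : PExpr) (p q : ℚ) : Set where
    field
      P Q  : ℚ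
      p≤P  : p ≤ P
      q≤Q  : q ≤ Q
      diff : pe s x ≡ P + - 1ℚ * Q
      tot  : σ S * pe (ωs s) x ≡ P + Q

  weaken : ∀ {S x p q p′ q′} → p′ ≤ p → q′ ≤ q → Bounds S x p q → Bounds S x p′ q′
  weaken p′≤p q′≤q B = record { P = P ; Q = Q ; p≤P = ≤-trans p′≤p p≤P ; q≤Q = ≤-trans q′≤q q≤Q ; diff = diff ; tot = tot }
    where open Bounds B

  bounds-[] : ∀ S → Bounds S (expand [] S) (prodFin (m S) (s ∘ w S)) 0ℚ
  bounds-[] S = record { P = Π ; Q = 0ℚ ; p≤P = ≤-refl ; q≤Q = ≤-refl
    ; diff = trans (pe-prodPsum (m S) (w S) s) (lem Π)
    ; tot = trans (cong (σ S *_) (pe-prodPsum (m S) (w S) (ωs s))) (trans (sym (prodFin-* (m S) (sgn ∘ w S) (ωs s ∘ w S)))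
        (trans (prodFin-cong (m S) λ u → trans (sym (*-assoc (sgn (w S u)) (sgn (w S u)) (s (w S u))))
          (trans (cong (_* s (w S u)) (sgn-square (w S u))) (*-identityˡ (s (w S u))))) (sym (+-identityʳ Π)))) }
    where
    Π = prodFin (m S) (s ∘ w S)
    lem : ∀ x → x ≡ x + - 1ℚ * 0ℚ
    lem = solve-∀ ringℚ

  bounds-loop : ∀ S → Bounds S (const 0ℚ) 0ℚ 0ℚ
  bounds-loop S = record { P = 0ℚ ; Q = 0ℚ ; p≤P = ≤-refl ; q≤Q = ≤-refl ; diff = refl ; tot = *-zeroʳ (σ S) }

  -- The contracted part is subtracted and its sign under ω is opposite, so its P counts towards Q
  -- and its Q towards P.
  bounds-contract : ∀ L S i j (i≢j : i ≢ j) {p q p′ q′} → Bounds S (expand L S) p q →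
    Bounds (contract S i j i≢j) (expand L (contract S i j i≢j)) p′ q′ →
    Bounds S (expandEdge L S i j (no i≢j)) (p + q′) (q + p′)
  bounds-contract L S i j i≢j B B′ = record
    { P = X.P + Y.Q ; Q = X.Q + Y.P
    ; p≤P = +-mono-≤ X.p≤P Y.q≤Q ; q≤Q = +-mono-≤ X.q≤Q Y.p≤P
    ; diff = trans (cong₂ (λ x y → x + - 1ℚ * y) X.diff Y.diff) (lem₁ X.P X.Q Y.P Y.Q)
    ; tot = trans (lem₂ (σ S) (pe (ωs s) (expand L S)) (pe (ωs s) (expand L S′)))
        (trans (cong₂ _+_ X.tot (trans (cong (_* pe (ωs s) (expand L S′)) (sym (σ-contract S i j i≢j))) Y.tot))
               (lem₃ X.P X.Q Y.P Y.Q)) }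
    where
    module X = Bounds B
    module Y = Bounds B′
    S′ = contract S i j i≢j
    lem₁ : ∀ a b c d → (a + - 1ℚ * b) + - 1ℚ * (c + - 1ℚ * d) ≡ (a + d) + - 1ℚ * (b + c)
    lem₁ = solve-∀ ringℚ
    lem₂ : ∀ σ x y → σ * (x + - 1ℚ * y) ≡ σ * x + (- 1ℚ * σ) * y
    lem₂ = solve-∀ ringℚ
    lem₃ : ∀ a b c d → (a + b) + (c + d) ≡ (a + d) + (b + c)
    lem₃ = solve-∀ ringℚ

  bounds-nonneg : ∀ L S → Bounds S (expand L S) 0ℚ 0ℚ
  bounds-nonneg []            S = weaken (prodFin-nonneg (m S) _ (λ u → 0≤s (w S u))) ≤-refl (bounds-[] S)
  bounds-nonneg ((a , b) ∷ L) S with adj a b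
  ... | false = bounds-nonneg L S
  ... | true with φ S a Fin.≟ φ S b
  ...   | yes _  = bounds-loop S
  ...   | no i≢j = bounds-contract L S _ _ i≢j (bounds-nonneg L S) (bounds-nonneg L _)

  bounds-edge : ∀ a b L S {p q} → adj a b ≡ true → φ S a ≢ φ S b →
    (∀ i≢j → Bounds S (expandEdge L S (φ S a) (φ S b) (no i≢j)) p q) → Bounds S (expand ((a , b) ∷ L) S) p q
  bounds-edge a b L S ab i≢j B rewrite ab with φ S a Fin.≟ φ S b
  ... | yes e   = ⊥-elim (i≢j e)
  ... | no i≢j′ = B i≢j′

  -- The branch that deletes every edge of `L` keeps `S` and hence the bound for `L′`; the
  -- contraction branches only add nonnegative amounts.
  bounds-++ : ∀ L L′ S {p} → (∀ a b → adj a b ≡ true → φ S a ≢ φ S b) →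
    Bounds S (expand L′ S) p 0ℚ → Bounds S (expand (L ++ L′) S) p 0ℚ
  bounds-++ []            L′ S loopless B = B
  bounds-++ ((a , b) ∷ L) L′ S loopless B with adj a b in ab
  ... | false = bounds-++ L L′ S loopless B
  ... | true with φ S a Fin.≟ φ S b
  ...   | yes e  = ⊥-elim (loopless a b ab e)
  ...   | no i≢j = weaken (≤-reflexive (sym (+-identityʳ _))) ≤-refl
                     (bounds-contract (L ++ L′) S _ _ i≢j (bounds-++ L L′ S loopless B) (bounds-nonneg (L ++ L′) _))

  module _ (s0≡1 : s 0 ≡ 1ℚ) where

    -- Uniting two singletons replaces two factors p_1, here equal to 1, by one factor p_2.
    prodFin-contract : ∀ S i j i≢j → w S i ≡ 0 → w S j ≡ 0 →
      prodFin (m (contract S i j i≢j)) (s ∘ w (contract S i j i≢j)) ≡ s 1 * prodFin (m S) (s ∘ w S)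
    prodFin-contract (state (suc m) w φ) i j i≢j wi wj = trans
      (prodFin-mergeWeight w (λ _ → s) (s 1) eq)
      (cong (s 1 *_) (sym (trans (prodFin-punchIn m j (s ∘ w))
        (trans (cong (_* prodFin m (λ u → s (w (punchIn j u)))) (trans (cong s wj) s0≡1))
               (*-identityˡ (prodFin m (λ u → s (w (punchIn j u)))))))))
      where
      open Merge i j i≢j
      eq : s (w i ℕ.+ suc (w j)) ≡ s 1 * s (w i)
      eq rewrite wi | wj = trans (sym (*-identityʳ (s 1))) (cong (s 1 *_) (sym s0≡1))

    contract-w : ∀ S i j i≢j v → φ S v ≢ i → φ S v ≢ j → w S (φ S v) ≡ 0 →
      w (contract S i j i≢j) (φ (contract S i j i≢j) v) ≡ 0
    contract-w (state (suc m) w φ) i j i≢j v v≢i v≢j e = trans (mergeWeight-off w (φ v) v≢i v≢j) e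
      where open Merge i j i≢j

    contract-φ : ∀ S i j i≢j v v′ → φ S v ≢ j → φ S v′ ≢ j → φ S v ≢ φ S v′ →
      φ (contract S i j i≢j) v ≢ φ (contract S i j i≢j) v′
    contract-φ (state (suc m) w φ) i j i≢j v v′ v≢j v′≢j v≢v′ e = v≢v′ (merge-injective (φ v) (φ v′) v≢j v′≢j e)
      where open Merge i j i≢j

    -- Contracting both edges yields p_2² times a power of p_1, and the two role changes of P and Q
    -- put it into P. Disjointness keeps c and d distinct singletons after the first contraction.
    bounds-disjoint : ∀ a b c d → adj a b ≡ true → adj c d ≡ true → a ≢ b → c ≢ d →
      c ≢ a → c ≢ b → d ≢ a → d ≢ b →
      Bounds discrete (expand ((a , b) ∷ (c , d) ∷ []) discrete) (s 1 * s 1) 0ℚ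
    bounds-disjoint a b c d ab cd a≢b c≢d c≢a c≢b d≢a d≢b =
      bounds-edge a b ((c , d) ∷ []) discrete ab a≢b λ a≢b →
      weaken (≤-reflexive (sym (+-identityˡ (s 1 * s 1)))) ≤-refl $
      bounds-contract ((c , d) ∷ []) discrete a b a≢b (bounds-nonneg ((c , d) ∷ []) discrete) $
      let S₁ = contract discrete a b a≢b in
      bounds-edge c d [] S₁ cd (contract-φ discrete a b a≢b c d c≢b d≢b c≢d) λ c≢d →
      weaken ≤-refl (≤-reflexive (sym (trans (+-identityˡ _) (trans
        (prodFin-contract S₁ _ _ c≢d (contract-w discrete a b a≢b c c≢a c≢b refl) (contract-w discrete a b a≢b d d≢a d≢b refl))
        (cong (s 1 *_) (trans (prodFin-contract discrete a b a≢b refl refl) (trans (cong (s 1 *_)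
          (trans (prodFin-cong n λ _ → s0≡1) (prodFin-1 n))) (*-identityʳ (s 1))))))))) $
      bounds-contract [] S₁ _ _ c≢d (bounds-nonneg [] S₁) (bounds-[] (contract S₁ _ _ c≢d))

module Expansion (G : Graph) where
  open Graph G using (n; adj)
  open DeletionContraction n adj public

  allPairs : Pairs
  allPairs = concatMap (λ i → map (i ,_) (allFin n)) (allFin n)

  allOk-allPairs : ∀ {N} (κ : Fin n → Fin N) →
    ind (allBool (map (ok κ) allPairs)) ≡ prodFin n (λ i → prodFin n (λ j → ind (compatible G κ i j)))
  allOk-allPairs κ = trans (cong (ind ∘ allBool) (List.map-concatMap (ok κ) (λ i → map (i ,_) (allFin n)) (allFin n)))
    (trans (ind-allBool-concatMap n (λ i → map (ok κ) (map (i ,_) (allFin n))) id)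
      (prodFin-cong n λ i → trans (cong (ind ∘ allBool) (sym (List.map-∘ (allFin n)))) (ind-allBool-map n (λ j → ok κ (i , j)) id)))

  -- Repeating pairs does not change the colourings but makes the pairs in L the last ones to be processed.
  allOk-redundant : ∀ {N} (κ : Fin n → Fin N) L →
    ind (allBool (map (ok κ) (allPairs ++ L))) ≡ prodFin n (λ i → prodFin n (λ j → ind (compatible G κ i j)))
  allOk-redundant κ L = trans (cong (ind ∘ allBool) (List.map-++ (ok κ) allPairs L))
    (trans (ind-allBool-++ (map (ok κ) allPairs) (map (ok κ) L)) (trans (cong (_* ind (allBool (map (ok κ) L))) (allOk-allPairs κ)) (absorb L)))
    where
    Π = prodFin n (λ i → prodFin n (λ j → ind (compatible G κ i j)))
    absorb : ∀ L → Π * ind (allBool (map (ok κ) L)) ≡ Π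
    absorb []            = *-identityʳ Π
    absorb ((a , b) ∷ L) = begin
      Π * ind (ok κ (a , b) ∧ allBool (map (ok κ) L))             ≡⟨ cong (Π *_) (ind-∧ (ok κ (a , b)) (allBool (map (ok κ) L))) ⟩
      Π * (ind (ok κ (a , b)) * ind (allBool (map (ok κ) L)))     ≡⟨ *-assoc Π _ _ ⟨
      Π * ind (ok κ (a , b)) * ind (allBool (map (ok κ) L))       ≡⟨ cong (_* ind (allBool (map (ok κ) L)))
        (prodFin-absorb n a (λ i → prodFin n (λ j → ind (compatible G κ i j))) _
          (prodFin-absorb n b (λ j → ind (compatible G κ a j)) _ (ind-idem (ok κ (a , b))))) ⟩
      Π * ind (allBool (map (ok κ) L))                            ≡⟨ absorb L ⟩
      Π ∎

  RepX-expand : ∀ L → RepX G (expand (allPairs ++ L) discrete)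
  RepX-expand L N ρ = trans (eval-expand (allPairs ++ L) discrete N ρ) (trans
    (sumVec-cong n N λ κ → cong₂ _*_ (prodFin-cong n λ u → *-identityʳ (ρ (lookup κ u))) (allOk-redundant (lookup κ) L))
    (sym (chromEval≡sumVec G N ρ)))

-- Near chromatic functions in Γ exclude disjoint edges

RepX-unique : ∀ G x x′ → RepX G x → RepX G x′ → x ≋ x′
RepX-unique G x x′ r r′ = ≈⇒≋ {x} {x′} λ N ρ → trans (r N ρ) (sym (r′ N ρ))

-- Representatives of X_G agree as polynomials in the power sums, so whichever expression is
-- convenient may replace the witness inside `NearChrom`.
pe-NearChrom : ∀ {G y} → NearChrom G y → ∀ x → RepX G x → ∀ s → pe s y ≡ ½ * (pe s x + pe (ωs s) x)
pe-NearChrom {G} {y} (x′ , rep′ , y≈) x rep s = trans (≈⇒≋ {y} {const ½ ⊗ (x′ ⊕ ω x′)} y≈ s)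
  (cong (½ *_) (cong₂ _+_ (RepX-unique G x′ x rep′ rep s)
    (trans (pe-ω s x′) (RepX-unique G x′ x rep′ rep (ωs s)))))

-- Give the power sums of odd degree the value 1 and those of even degree the value t. An element of
-- Γ then has a constant value C, while disjoint edges force a value of at least t²; t = 1 + C is
-- impossible.
no-disjoint-edges : ∀ G y → NearChrom G y → InΓ y → ∀ a b c d →
  Graph.adj G a b ≡ true → Graph.adj G c d ≡ true → c ≢ a → c ≢ b → d ≢ a → d ≢ b → ⊥
no-disjoint-edges G y near (q , odd , y≈q) a b c d ab cd c≢a c≢b d≢a d≢b =
  <-irrefl refl (<-≤-trans (C<[1+C]²) (large (1ℚ + C) 0≤1+C))
  where
  open Graph G using (n; adj; irrefl)
  open Expansion G
  edge-≢ : ∀ {u v} → adj u v ≡ true → u ≢ v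
  edge-≢ {u} uv refl with trans (sym (irrefl u)) uv
  ... | ()
  even-odd : ℚ → ℕ → ℚ
  even-odd t r = if even r then 1ℚ else t
  C : ℚ
  C = pe (λ _ → 1ℚ) q
  constant : ∀ t → pe (even-odd t) y ≡ C
  constant t = trans (≈⇒≋ {y} {q} y≈q (even-odd t)) (pe-OnlyOdd q odd λ r e → cong (λ z → if z then 1ℚ else t) e)
  large : ∀ t → 0ℚ ≤ t → t * t ≤ C
  large t 0≤t = ≡.subst (t * t ≤_) (sym P≡C) (Bounds.p≤P B)
    where
    s = even-odd t
    0≤s : ∀ r → 0ℚ ≤ s r
    0≤s r with even r
    ... | true  = nonNegative⁻¹ 1ℚ
    ... | false = 0≤t
    open SignedBounds n adj s 0≤s
    x = expand (allPairs ++ (a , b) ∷ (c , d) ∷ []) discrete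
    B : Bounds discrete x (t * t) 0ℚ
    B = bounds-++ allPairs _ discrete (λ u v → edge-≢)
          (bounds-disjoint refl a b c d ab cd (edge-≢ ab) (edge-≢ cd) c≢a c≢b d≢a d≢b)
    lem : ∀ P Q → ½ * ((P + - 1ℚ * Q) + (P + Q)) ≡ P
    lem P Q = trans (solve₁ ½ P Q) (*-identityˡ P)
      where
      solve₁ : ∀ h P Q → h * ((P + - 1ℚ * Q) + (P + Q)) ≡ (h + h) * P
      solve₁ = solve-∀ ringℚ
    P≡C : C ≡ Bounds.P B
    P≡C = begin
      C                               ≡⟨ constant t ⟨
      pe s y                          ≡⟨ pe-NearChrom {G} {y} near x (RepX-expand _) s ⟩
      ½ * (pe s x + pe (ωs s) x)      ≡⟨ cong (λ z → ½ * (pe s x + z)) (trans (sym (*-identityˡ (pe (ωs s) x)))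
                                           (cong (_* pe (ωs s) x) (sym (prodFin-1 n)))) ⟩
      ½ * (pe s x + σ discrete * pe (ωs s) x)
                                      ≡⟨ cong (½ *_) (cong₂ _+_ (Bounds.diff B) (Bounds.tot B)) ⟩
      ½ * ((Bounds.P B + - 1ℚ * Bounds.Q B) + (Bounds.P B + Bounds.Q B))
                                      ≡⟨ lem (Bounds.P B) (Bounds.Q B) ⟩
      Bounds.P B                      ∎
  0≤C : 0ℚ ≤ C
  0≤C = ≤-trans (nonNegative⁻¹ 1ℚ) (large 1ℚ (nonNegative⁻¹ 1ℚ))
  0≤1+C : 0ℚ ≤ 1ℚ + C
  0≤1+C = +-mono-≤ (nonNegative⁻¹ 1ℚ) 0≤C
  C<[1+C]² : C < (1ℚ + C) * (1ℚ + C)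
  C<[1+C]² = ≡.subst₂ _<_ (trans (+-identityʳ _) (+-identityʳ C)) (lem C)
    (+-mono-<-≤ (+-monoʳ-< C (positive⁻¹ 1ℚ)) (nonNegative⁻¹ (C * (1ℚ + C)) {{nonNeg*nonNeg⇒nonNeg C {{nonNegative 0≤C}} (1ℚ + C) {{nonNegative 0≤1+C}}}}))
    where
    lem : ∀ c → (c + 1ℚ) + c * (1ℚ + c) ≡ (1ℚ + c) * (1ℚ + c)
    lem = solve-∀ ringℚ

-- Values on the ray u ↦ (p_{2i+1} = u, all other power sums 0)

spike : ℕ → ℚ → ℕ → ℚ
spike i u = overwrite (2 ℕ.* i) u (λ _ → 0ℚ)

spike-at : ∀ i u → spike i u (2 ℕ.* i) ≡ u
spike-at i u = overwrite-at (2 ℕ.* i) u (λ _ → 0ℚ)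

spike-off : ∀ i u r → r ≢ 2 ℕ.* i → spike i u r ≡ 0ℚ
spike-off i u r = overwrite-off (2 ℕ.* i) u (λ _ → 0ℚ) r

-- ω fixes p_{2i+1}, so on this ray X_G and Y_G take the same values.
ωs-spike : ∀ i u r → ωs (spike i u) r ≡ spike i u r
ωs-spike i u r with r ℕ.≟ 2 ℕ.* i
... | yes refl rewrite even-2* i = *-identityˡ u
... | no _     = *-zeroʳ (sgn r)

pe-spike-poly : ∀ i q → Σ (Poly 1) λ p → ∀ u → pe (spike i u) q ≡ ev₁ p u
pe-spike-poly i q with pe-line q (λ _ → 0ℚ) (spike i 1ℚ)
... | p , e = p , λ u → trans (pe-cong q (on-line u)) (e u)
  where
  on-line : ∀ u r → spike i u r ≡ 0ℚ + u * spike i 1ℚ r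
  on-line u r with r ℕ.≟ 2 ℕ.* i
  ... | yes _ = sym (trans (+-identityˡ _) (*-identityʳ u))
  ... | no _  = sym (trans (+-identityˡ _) (*-zeroʳ u))

-- The derivative at 0 vanishes. Because the constant c is free, such functions form an algebra, so
-- no polynomial in them can equal u.
NoLinearTerm : (ℚ → ℚ) → Set
NoLinearTerm f = Σ ℚ λ c → Σ (Poly 1) λ h → ∀ u → f u ≡ c + u * (u * ev₁ h u)

noLinear-const : ∀ c → NoLinearTerm (λ _ → c)
noLinear-const c = c , [] , λ u → lem c u
  where
  lem : ∀ c u → c ≡ c + u * (u * 0ℚ)
  lem = solve-∀ ringℚ

noLinear-cong : ∀ {f g : ℚ → ℚ} → (∀ u → f u ≡ g u) → NoLinearTerm g → NoLinearTerm f
noLinear-cong e (c , h , eh) = c , h , λ u → trans (e u) (eh u)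

noLinear-+ : ∀ {f g} → NoLinearTerm f → NoLinearTerm g → NoLinearTerm (λ u → f u + g u)
noLinear-+ (c , h , eh) (d , k , ek) = c + d , addP 1 h k , λ u → trans (cong₂ _+_ (eh u) (ek u))
  (trans (lem c d u (ev₁ h u) (ev₁ k u)) (cong (λ z → (c + d) + u * (u * z)) (sym (evP-add 1 h k (λ _ → u)))))
  where
  lem : ∀ c d u h k → (c + u * (u * h)) + (d + u * (u * k)) ≡ (c + d) + u * (u * (h + k))
  lem = solve-∀ ringℚ

noLinear-* : ∀ {f g} → NoLinearTerm f → NoLinearTerm g → NoLinearTerm (λ u → f u * g u)
noLinear-* (c , h , eh) (d , k , ek) = c * d , hk , λ u → trans (cong₂ _*_ (eh u) (ek u))
  (trans (lem c d u (ev₁ h u) (ev₁ k u)) (cong (λ z → c * d + u * (u * z)) (sym (eval-hk u))))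
  where
  hk : Poly 1
  -- The list `d ∷ 0ℚ ∷ k` is d + u² k, and (c + u² h)(d + u² k) = cd + u² (ck + h (d + u² k)).
  hk = addP 1 (mulP 1 (c ∷ []) k) (mulP 1 h (d ∷ 0ℚ ∷ k))
  eval-hk : ∀ u → ev₁ hk u ≡ (c + u * 0ℚ) * ev₁ k u + ev₁ h u * (d + u * (0ℚ + u * ev₁ k u))
  eval-hk u = trans (evP-add 1 (mulP 1 (c ∷ []) k) (mulP 1 h (d ∷ 0ℚ ∷ k)) (λ _ → u))
    (cong₂ _+_ (evP-mul 1 (c ∷ []) k (λ _ → u)) (evP-mul 1 h (d ∷ 0ℚ ∷ k) (λ _ → u)))
  lem : ∀ c d u h k → (c + u * (u * h)) * (d + u * (u * k)) ≡
    c * d + u * (u * ((c + u * 0ℚ) * k + h * (d + u * (0ℚ + u * k))))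
  lem = solve-∀ ringℚ

noLinear-evP : ∀ k f (t : ℚ → Fin k → ℚ) → (∀ j → NoLinearTerm (λ u → t u j)) → NoLinearTerm (λ u → evP k f (t u))
noLinear-evP zero    c        t h = noLinear-const c
noLinear-evP (suc k) []       t h = noLinear-const 0ℚ
noLinear-evP (suc k) (c ∷ cs) t h =
  noLinear-+ (noLinear-evP k c (λ u → t u ∘ suc) (h ∘ suc)) (noLinear-* (h zero) (noLinear-evP (suc k) cs t h))

noLinear-u* : ∀ (p : Poly 1) → ev₁ p 0ℚ ≡ 0ℚ → NoLinearTerm (λ u → u * ev₁ p u)
noLinear-u* []      _ = 0ℚ , [] , λ u → lem u
  where
  lem : ∀ u → u * 0ℚ ≡ 0ℚ + u * (u * 0ℚ)
  lem = solve-∀ ringℚ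
noLinear-u* (c ∷ p) e = 0ℚ , p , λ u → trans (cong (λ z → u * (z + u * ev₁ p u)) c≡0) (lem u (ev₁ p u))
  where
  c≡0 : c ≡ 0ℚ
  c≡0 = trans (sym (+-identityʳ c)) (trans (cong (c +_) (sym (*-zeroˡ (ev₁ p 0ℚ)))) e)
  lem : ∀ u h → u * (0ℚ + u * h) ≡ 0ℚ + u * (u * h)
  lem = solve-∀ ringℚ

¬noLinear-linear : ∀ a → a ≢ 0ℚ → ¬ NoLinearTerm (λ u → a * u)
-- The list holds the coefficients of c + a u - u² h(u), which vanishes identically once u = 0 has
-- given c = 0.
¬noLinear-linear a a≢0 (c , h , e) = a≢0 (All.head (All.tail (vanishes⇒coeffs≡0 (c ∷ a ∷ map (- 1ℚ *_) h) zeroes′)))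
  where
  c≡0 : c ≡ 0ℚ
  c≡0 = trans (lem c (ev₁ h 0ℚ)) (trans (sym (e 0ℚ)) (*-zeroʳ a))
    where
    lem : ∀ c h → c ≡ c + 0ℚ * (0ℚ * h)
    lem = solve-∀ ringℚ
  ev-neg : ∀ h u → ev₁ (map (- 1ℚ *_) h) u ≡ - 1ℚ * ev₁ h u
  ev-neg []      u = refl
  ev-neg (d ∷ h) u = trans (cong (λ z → - 1ℚ * d + u * z) (ev-neg h u)) (lem d u (ev₁ h u))
    where
    lem : ∀ d u h → - 1ℚ * d + u * (- 1ℚ * h) ≡ - 1ℚ * (d + u * h)
    lem = solve-∀ ringℚ
  zeroes′ : ∀ u → ev₁ (c ∷ a ∷ map (- 1ℚ *_) h) u ≡ 0ℚ
  zeroes′ u = begin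
    c + u * (a + u * ev₁ (map (- 1ℚ *_) h) u)           ≡⟨ cong₂ (λ x y → x + u * (a + u * y)) c≡0 (ev-neg h u) ⟩
    0ℚ + u * (a + u * (- 1ℚ * ev₁ h u))                 ≡⟨ lem₁ u a (ev₁ h u) ⟩
    a * u + - 1ℚ * (0ℚ + u * (u * ev₁ h u))             ≡⟨ cong₂ (λ x y → x + - 1ℚ * (y + u * (u * ev₁ h u))) (e u) (sym c≡0) ⟩
    (c + u * (u * ev₁ h u)) + - 1ℚ * (c + u * (u * ev₁ h u))
                                                        ≡⟨ lem₂ (c + u * (u * ev₁ h u)) ⟩
    0ℚ                                                  ∎
    where
    lem₁ : ∀ u a h → 0ℚ + u * (a + u * (- 1ℚ * h)) ≡ a * u + - 1ℚ * (0ℚ + u * (u * h))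
    lem₁ = solve-∀ ringℚ
    lem₂ : ∀ x → x + - 1ℚ * x ≡ 0ℚ
    lem₂ = solve-∀ ringℚ

Flat : ℕ → PExpr → Set
Flat i q = NoLinearTerm (λ u → pe (spike i u) q)

-- For i > 0 the factor p_1 vanishes on the ray. For i = 0 it equals u, and the linear term of the
-- product is u times the constant term of `x`, which is zero.
flat-psum0⊗ : ∀ i x → pe (λ _ → 0ℚ) x ≡ 0ℚ → Flat i (psum 0 ⊗ x)
flat-psum0⊗ zero x x0 with pe-spike-poly 0 x
... | p , e = noLinear-cong (λ u → cong₂ _*_ (spike-at 0 u) (e u))
  (noLinear-u* p (trans (sym (e 0ℚ)) (trans (pe-cong x zeroes) x0)))
  where
  zeroes : ∀ r → spike 0 0ℚ r ≡ 0ℚ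
  zeroes r with r ℕ.≟ 0
  ... | yes _ = refl
  ... | no _  = refl
flat-psum0⊗ (suc i) x x0 = noLinear-cong
  (λ u → trans (cong (_* pe (spike (suc i) u) x) (spike-off (suc i) u 0 λ ())) (*-zeroˡ (pe (spike (suc i) u) x)))
  (noLinear-const 0ℚ)

half-double : ∀ x → ½ * (x + x) ≡ x
half-double x = trans (lem ½ x) (*-identityˡ x)
  where
  lem : ∀ h x → h * (x + x) ≡ (h + h) * x
  lem = solve-∀ ringℚ

flat-NearChrom : ∀ i {G y} → NearChrom G y → ∀ x → RepX G x → Flat i x → Flat i y
flat-NearChrom i {G} {y} near x rep = noLinear-cong λ u → trans (pe-NearChrom {G} {y} near x rep (spike i u))
  (trans (cong (λ z → ½ * (pe (spike i u) x + z)) (pe-cong x (ωs-spike i u)))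
    (half-double (pe (spike i u) x)))

pe0-starX : ∀ k e → pe (λ _ → 0ℚ) (starX k e) ≡ 0ℚ
pe0-starX zero    e = refl
pe0-starX (suc k) e = cong₂ (λ x y → 0ℚ * x + - 1ℚ * y) (pe0-starX k e) (pe0-starX k (suc e))

flat-scale : ∀ i c q → Flat i q → Flat i (const c ⊗ q)
flat-scale i c q = noLinear-* (noLinear-const c)

flat-psum : ∀ i r → r ≢ 2 ℕ.* i → Flat i (psum r)
flat-psum i r r≢ = noLinear-cong (λ u → spike-off i u r r≢) (noLinear-const 0ℚ)

-- Every summand with a factor p_1 is flat, so unrolling the recursion leaves only p_{e+k+1} up to
-- sign.
flat-starX : ∀ i k e → e ℕ.+ k ≢ 2 ℕ.* i → Flat i (starX k e)
flat-starX i zero    e ne = flat-psum i e (ne ∘ trans (ℕ.+-identityʳ e))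
flat-starX i (suc k) e ne = noLinear-+ (flat-psum0⊗ i (starX k e) (pe0-starX k e))
  (flat-scale i (- 1ℚ) (starX k (suc e)) (flat-starX i k (suc e) (ne ∘ trans (ℕ.+-suc e k))))

flat-triangleX : ∀ i → i ≢ 1 → Flat i triangleX
flat-triangleX i i≢1 = noLinear-+ (flat-psum0⊗ i (psum 0 ⊗ psum 0) refl)
  (noLinear-+ (flat-scale i (- 1ℚ) ((psum 0 ⊗ psum 1) ⊕ ((psum 0 ⊗ psum 1) ⊕ (psum 0 ⊗ psum 1)))
                (noLinear-+ p₁p₂ (noLinear-+ p₁p₂ p₁p₂)))
              (noLinear-+ p₃ p₃))
  where
  p₁p₂ = flat-psum0⊗ i (psum 1) refl
  p₃ = flat-psum i 2 λ e → i≢1 (sym (ℕ.*-cancelˡ-≡ 1 i 2 e))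

-- Near chromatic symmetric functions of stars and the triangle

-- The image of starX under (1 + ω)/2. Since p_1 is fixed by ω, only the last factor p_{e+1} is affected.
starY : ℕ → ℕ → PExpr
starY zero    e = if even e then psum e else const 0ℚ
starY (suc k) e = (psum 0 ⊗ starY k e) ⊕ (const (- 1ℚ) ⊗ starY k (suc e))

-- The term -3 p_1 p_2 of `triangleX` changes sign under ω and drops out of the average.
triangleY : PExpr
triangleY = (psum 0 ⊗ (psum 0 ⊗ psum 0)) ⊕ (psum 2 ⊕ psum 2)

pe-starY : ∀ k e s → ½ * (pe s (starX k e) + pe (ωs s) (starX k e)) ≡ pe s (starY k e)
pe-starY zero e s with even e
... | true  = trans (cong (λ z → ½ * (s e + z)) (*-identityˡ (s e))) (half-double (s e))
... | false = lem (s e)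
  where
  lem : ∀ x → ½ * (x + - 1ℚ * x) ≡ 0ℚ
  lem = solve-∀ ringℚ
pe-starY (suc k) e s = trans (lem ½ (s 0) (pe s (starX k e)) (pe s (starX k (suc e))) (pe (ωs s) (starX k e)) (pe (ωs s) (starX k (suc e))))
  (cong₂ (λ x y → s 0 * x + - 1ℚ * y) (pe-starY k e s) (pe-starY k (suc e) s))
  where
  lem : ∀ h p a b c d → h * ((p * a + - 1ℚ * b) + ((1ℚ * p) * c + - 1ℚ * d)) ≡ p * (h * (a + c)) + - 1ℚ * (h * (b + d))
  lem = solve-∀ ringℚ

pe-triangleY : ∀ s → ½ * (pe s triangleX + pe (ωs s) triangleX) ≡ pe s triangleY
pe-triangleY s = trans (lem₁ ½ (s 0) (s 1) (s 2)) (lem₂ (s 0) (s 2))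
  where
  lem₁ : ∀ h p q r →
    h * ((p * (p * p) + (- 1ℚ * (p * q + (p * q + p * q)) + (r + r))) +
         ((1ℚ * p) * ((1ℚ * p) * (1ℚ * p)) + (- 1ℚ * ((1ℚ * p) * (- 1ℚ * q) + ((1ℚ * p) * (- 1ℚ * q) + (1ℚ * p) * (- 1ℚ * q))) + (1ℚ * r + 1ℚ * r))))
    ≡ (h + h) * (p * (p * p) + (r + r))
  lem₁ = solve-∀ ringℚ
  lem₂ : ∀ p r → 1ℚ * (p * (p * p) + (r + r)) ≡ p * (p * p) + (r + r)
  lem₂ = solve-∀ ringℚ

NearChrom-≋ : ∀ {G y} x y′ → RepX G x → (∀ s → ½ * (pe s x + pe (ωs s) x) ≡ pe s y′) → NearChrom G y → y ≋ y′
NearChrom-≋ {G} {y} x y′ rep e near s = trans (pe-NearChrom {G} {y} near x rep s) (e s)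

≋-NearChrom : ∀ {G y} x y′ → RepX G x → (∀ s → ½ * (pe s x + pe (ωs s) x) ≡ pe s y′) → y ≋ y′ → NearChrom G y
≋-NearChrom {G} {y} x y′ rep e y≋ = x , rep , ≋⇒≈ {y} {const ½ ⊗ (x ⊕ ω x)} λ s →
  trans (y≋ s) (trans (sym (e s)) (cong (λ z → ½ * (pe s x + z)) (sym (pe-ω s x))))

OnlyOdd-starY : ∀ k e → OnlyOdd (starY k e)
OnlyOdd-starY zero e with even e in eq
... | true  = eq
... | false = tt
OnlyOdd-starY (suc k) e = (refl , OnlyOdd-starY k e) , (tt , OnlyOdd-starY k (suc e))

supp-starY : ∀ k e → supp (starY k e) ℕ.≤ suc (e ℕ.+ k)
supp-starY zero e with even e
... | true  = s≤s (ℕ.m≤m+n e 0)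
... | false = z≤n
supp-starY (suc k) e = ℕ.⊔-lub
  (ℕ.⊔-lub (s≤s z≤n) (ℕ.≤-trans (supp-starY k e) (s≤s (ℕ.+-monoʳ-≤ e (ℕ.n≤1+n k)))))
  (ℕ.≤-trans (supp-starY k (suc e)) (s≤s (ℕ.≤-reflexive (sym (ℕ.+-suc e k)))))

-- What remains of `starY` without its leading term (-1)^k p_{e+k+1}, the end of the chain of
-- subtractions.
starRest : ℕ → ℕ → PExpr
starRest zero    e = const 0ℚ
starRest (suc k) e = (psum 0 ⊗ starY k e) ⊕ (const (- 1ℚ) ⊗ starRest k (suc e))

OnlyOdd-starRest : ∀ k e → OnlyOdd (starRest k e)
OnlyOdd-starRest zero    e = tt
OnlyOdd-starRest (suc k) e = (refl , OnlyOdd-starY k e) , (tt , OnlyOdd-starRest k (suc e))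

supp-starRest : ∀ k e → supp (starRest k e) ℕ.≤ e ℕ.+ k
supp-starRest zero    e = z≤n
supp-starRest (suc k) e rewrite ℕ.+-suc e k =
  ℕ.⊔-lub (ℕ.⊔-lub (s≤s z≤n) (supp-starY k e)) (supp-starRest k (suc e))

starY-split : ∀ k e s → even (e ℕ.+ k) ≡ true → pe s (starY k e) ≡ qpow (- 1ℚ) k * s (e ℕ.+ k) + pe s (starRest k e)
starY-split zero e s h rewrite ℕ.+-identityʳ e | h = sym (trans (+-identityʳ _) (*-identityˡ (s e)))
starY-split (suc k) e s h = trans
  (cong (λ z → s 0 * pe s (starY k e) + - 1ℚ * z)
    (trans (starY-split k (suc e) s (trans (cong even (sym (ℕ.+-suc e k))) h))
           (cong (λ z → qpow (- 1ℚ) k * s z + pe s (starRest k (suc e))) (sym (ℕ.+-suc e k)))))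
  (lem (s 0) (pe s (starY k e)) (qpow (- 1ℚ) k) (s (e ℕ.+ suc k)) (pe s (starRest k (suc e))))
  where
  lem : ∀ p a q x r → p * a + - 1ℚ * (q * x + r) ≡ (- 1ℚ * q) * x + (p * a + - 1ℚ * r)
  lem = solve-∀ ringℚ

qpow-neg1≢0 : ∀ k → qpow (- 1ℚ) k ≢ 0ℚ
qpow-neg1≢0 zero    = 1≢0
qpow-neg1≢0 (suc k) = x*y≢0 { - 1ℚ} {qpow (- 1ℚ) k} (λ ()) (qpow-neg1≢0 k)

basisB : ℕ → PExpr
basisB i = starY (2 ℕ.* i) 0

basisA : ℕ → PExpr
basisA zero          = basisB 0
basisA (suc zero)    = triangleY
basisA (suc (suc i)) = basisB (suc (suc i))

triangularB : Triangular basisB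
triangularB = record
  { coeff   = λ i → qpow (- 1ℚ) (2 ℕ.* i)
  ; coeff≢0 = λ i → qpow-neg1≢0 (2 ℕ.* i)
  ; rest    = λ i → starRest (2 ℕ.* i) 0
  ; odd     = λ i → OnlyOdd-starRest (2 ℕ.* i) 0
  ; below   = λ i → supp-starRest (2 ℕ.* i) 0
  ; split   = λ i s → starY-split (2 ℕ.* i) 0 s (even-2* i)
  }

triangularA : Triangular basisA
triangularA = record
  { coeff   = λ { (suc zero) → 2ℚ ; i → ΔB.coeff i }
  ; coeff≢0 = λ { zero → ΔB.coeff≢0 0 ; (suc zero) () ; (suc (suc i)) → ΔB.coeff≢0 (suc (suc i)) }
  ; rest    = λ { (suc zero) → psum 0 ⊗ (psum 0 ⊗ psum 0) ; i → ΔB.rest i }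
  ; odd     = λ { zero → ΔB.odd 0 ; (suc zero) → refl , refl , refl ; (suc (suc i)) → ΔB.odd (suc (suc i)) }
  ; below   = λ { zero → ΔB.below 0 ; (suc zero) → s≤s z≤n ; (suc (suc i)) → ΔB.below (suc (suc i)) }
  ; split   = λ { zero → ΔB.split 0 ; (suc zero) s → trans (+-comm (s 0 * (s 0 * s 0)) (s 2 + s 2)) (cong (_+ s 0 * (s 0 * s 0)) (sym (double (s 2))))
                ; (suc (suc i)) → ΔB.split (suc (suc i)) }
  }
  where module ΔB = Triangular triangularB

-- Graphs without two disjoint edges

module NoDisjointEdges (m : ℕ) (adj : Fin (suc m) → Fin (suc m) → Bool)
  (adj-sym : ∀ i j → adj i j ≡ adj j i) (adj-irrefl : ∀ i → adj i i ≡ false)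
  (disjoint : ∀ a b c d → adj a b ≡ true → adj c d ≡ true → c ≢ a → c ≢ b → d ≢ a → d ≢ b → ⊥) where

  -- A single vertex counts as `starlike`. With a further vertex required, removing the vertex of
  -- `isolated` leaves a nonempty graph, whose chromatic function has no constant term.
  data Shape : Set where
    starlike : ∀ a → (∀ v → v ≢ a → adj a v ≡ true) → (∀ u v → u ≢ a → v ≢ a → adj u v ≡ false) → Shape
    triangle : m ≡ 2 → (∀ u v → not (u == v) ≡ adj u v) → Shape
    isolated : m ≢ 0 → ∀ a → (∀ v → adj a v ≡ false) → Shape

  edge-≢ : ∀ {u v} → adj u v ≡ true → u ≢ v
  edge-≢ {u} uv refl with trans (sym (adj-irrefl u)) uv
  ... | ()

  flip : ∀ {u v} → adj u v ≡ true → adj v u ≡ true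
  flip {u} {v} = trans (adj-sym v u)

  module _ (neighbour : ∀ v → Σ (Fin (suc m)) λ u → adj v u ≡ true) where

    -- Here p has q as its only neighbour. Any other vertex has some neighbour, and this must be q,
    -- since otherwise that edge would be disjoint from pq.
    centre : ∀ p q → adj p q ≡ true → (∀ v → v ≢ q → adj v p ≡ true → ⊥) → Shape
    centre p q pq only = starlike q towards away
      where
      towards : ∀ v → v ≢ q → adj q v ≡ true
      towards v v≢q with v Fin.≟ p | neighbour v
      ... | yes refl | _ = flip pq
      ... | no v≢p | u , vu with u Fin.≟ q | u Fin.≟ p
      ... | yes refl | _        = flip vu
      ... | no _     | yes refl = ⊥-elim (only v v≢q vu)
      ... | no u≢q   | no u≢p   = ⊥-elim (disjoint p q v u pq vu v≢p v≢q u≢p u≢q)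
      away′ : ∀ u v → u ≢ q → v ≢ q → adj u v ≡ true → ⊥
      away′ u v u≢q v≢q uv with u Fin.≟ p | v Fin.≟ p
      ... | yes refl | _        = only v v≢q (flip uv)
      ... | no _     | yes refl = only u u≢q uv
      ... | no u≢p   | no v≢p   = disjoint p q u v pq uv u≢p u≢q v≢p v≢q
      away : ∀ u v → u ≢ q → v ≢ q → adj u v ≡ false
      away u v u≢q v≢q = Bool.¬-not (away′ u v u≢q v≢q)

    -- A further vertex z would have a neighbour, and the edge to it misses both ends of some side
    -- of the triangle. So p, q, r are all the vertices.
    three : ∀ p q r → adj p q ≡ true → adj r p ≡ true → adj r q ≡ true → Shape
    three p q r pq rp rq = triangle (ℕ.suc-injective (ℕ.≤-antisym (Fin.injective⇒≤ code-injective) (Fin.injective⇒≤ vertex-injective))) complete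
      where
      vertex : Fin 3 → Fin (suc m)
      vertex zero             = p
      vertex (suc zero)       = q
      vertex (suc (suc zero)) = r
      vertex-edge : ∀ i j → i ≢ j → adj (vertex i) (vertex j) ≡ true
      vertex-edge zero             zero             i≢j = ⊥-elim (i≢j refl)
      vertex-edge zero             (suc zero)       _   = pq
      vertex-edge zero             (suc (suc zero)) _   = flip rp
      vertex-edge (suc zero)       zero             _   = flip pq
      vertex-edge (suc zero)       (suc zero)       i≢j = ⊥-elim (i≢j refl)
      vertex-edge (suc zero)       (suc (suc zero)) _   = flip rq
      vertex-edge (suc (suc zero)) zero             _   = rp
      vertex-edge (suc (suc zero)) (suc zero)       _   = rq
      vertex-edge (suc (suc zero)) (suc (suc zero)) i≢j = ⊥-elim (i≢j refl)
      vertex-injective : ∀ {i j} → vertex i ≡ vertex j → i ≡ j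
      vertex-injective {i} {j} e with i Fin.≟ j
      ... | yes i≡j = i≡j
      ... | no i≢j  = ⊥-elim (edge-≢ (vertex-edge i j i≢j) e)
      cover : ∀ z → Σ (Fin 3) λ i → vertex i ≡ z
      cover z with z Fin.≟ p | z Fin.≟ q | z Fin.≟ r
      ... | yes z≡p | _       | _       = zero , sym z≡p
      ... | no _    | yes z≡q | _       = suc zero , sym z≡q
      ... | no _    | no _    | yes z≡r = suc (suc zero) , sym z≡r
      ... | no z≢p  | no z≢q  | no z≢r with neighbour z
      ... | u , zu with u Fin.≟ p | u Fin.≟ q
      ... | yes refl | _        = ⊥-elim (disjoint r q z p rq zu z≢r z≢q (edge-≢ (flip rp)) (edge-≢ pq))
      ... | no _     | yes refl = ⊥-elim (disjoint r p z q rp zu z≢r z≢p (edge-≢ (flip rq)) (edge-≢ (flip pq)))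
      ... | no u≢p   | no u≢q   = ⊥-elim (disjoint p q z u pq zu z≢p z≢q u≢p u≢q)
      code : Fin (suc m) → Fin 3
      code z = proj₁ (cover z)
      code-injective : ∀ {y z} → code y ≡ code z → y ≡ z
      code-injective {y} {z} e = trans (sym (proj₂ (cover y))) (trans (cong vertex e) (proj₂ (cover z)))
      complete : ∀ u v → not (u == v) ≡ adj u v
      complete u v with u Fin.≟ v
      ... | yes refl = sym (adj-irrefl u)
      ... | no u≢v   = sym (≡.subst₂ (λ x y → adj x y ≡ true) (proj₂ (cover u)) (proj₂ (cover v))
                         (vertex-edge (code u) (code v) (u≢v ∘ code-injective)))

    -- Look for a second edge at p and a second one at q. If one is missing, there is a star; if
    -- both exist, they must meet in a common third vertex, since otherwise they are disjoint.
    connectedShape : ∀ p q → adj p q ≡ true → Shape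
    connectedShape p q pq
      with Fin.any? (λ v → ¬? (v Fin.≟ q) ×-dec (adj v p Bool.≟ true))
         | Fin.any? (λ v → ¬? (v Fin.≟ p) ×-dec (adj v q Bool.≟ true))
    ... | no none | _       = centre p q pq λ v v≢q vp → none (v , v≢q , vp)
    ... | yes _   | no none = centre q p (flip pq) λ v v≢p vq → none (v , v≢p , vq)
    ... | yes (v , v≢q , vp) | yes (v′ , v′≢p , v′q) with v′ Fin.≟ v
    ... | yes refl = three p q v pq vp v′q
    ... | no v′≢v  = ⊥-elim (disjoint v p v′ q vp v′q v′≢v v′≢p (v≢q ∘ sym) (edge-≢ (flip pq)))

  shape : Shape
  shape with m ℕ.≟ 0
  ... | yes refl = starlike zero (λ { zero v≢a → ⊥-elim (v≢a refl) }) (λ { zero v u≢a → ⊥-elim (u≢a refl) })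
  ... | no m≢0 with Fin.all? (λ v → Fin.any? (λ u → adj v u Bool.≟ true))
  ... | yes neighbour = connectedShape neighbour zero (proj₁ (neighbour zero)) (proj₂ (neighbour zero))
  ... | no ¬neighbour with Fin.¬∀⟶∃¬ (suc m) _ (λ v → Fin.any? (λ u → adj v u Bool.≟ true)) ¬neighbour
  ... | a , none = isolated m≢0 a λ v → Bool.¬-not λ av → none (v , av)


-- The alphabet without letters makes all power sums zero, and a nonempty graph has no colouring
-- from an empty set of colours.
pe0-nonempty : ∀ G x → RepX G x → Graph.n G ≢ 0 → pe (λ _ → 0ℚ) x ≡ 0ℚ
pe0-nonempty G x rep n≢0 = trans (sym (eval≡pe 0 (λ ()) x)) (trans (rep 0 (λ ()))
  (trans (chromEval≡sumVec G 0 (λ ())) (sumVec-0 (Graph.n G) n≢0 (λ κ → colourWeight G 0 (λ ()) (lookup κ)))))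
  where
  sumVec-0 : ∀ n → n ≢ 0 → (F : Vec (Fin 0) n → ℚ) → sumVec n 0 F ≡ 0ℚ
  sumVec-0 zero    n≢0 F = ⊥-elim (n≢0 refl)
  sumVec-0 (suc n) n≢0 F = refl

-- Classification of the near chromatic functions in Γ

Classified : PExpr → Set
Classified y = ∀ i → (y ≋ basisB i) ⊎ (i ≡ 1 × y ≋ triangleY) ⊎ Flat i y

classify-empty : ∀ G y → Graph.n G ≡ 0 → NearChrom G y → Classified y
classify-empty G@(record { n = .0 }) y refl near i =
  inj₂ (inj₂ (flat-NearChrom i {G} {y} near (const 1ℚ) (λ N ρ → sym (chromEval≡sumVec G N ρ)) (noLinear-const 1ℚ)))

classify-star : ∀ G y m → RepX G (starX m 0) → NearChrom G y → Classified y
classify-star G y m rep near i with m ℕ.≟ 2 ℕ.* i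
... | yes e  = inj₁ λ s → trans (NearChrom-≋ {G} {y} (starX m 0) (starY m 0) rep (pe-starY m 0) near s)
                                (cong (λ k → pe s (starY k 0)) e)
... | no m≢  = inj₂ (inj₂ (flat-NearChrom i {G} {y} near (starX m 0) rep (flat-starX i m 0 m≢)))

classify-triangle : ∀ G y → RepX G triangleX → NearChrom G y → Classified y
classify-triangle G y rep near i with i ℕ.≟ 1
... | yes i≡1 = inj₂ (inj₁ (i≡1 , NearChrom-≋ {G} {y} triangleX triangleY rep pe-triangleY near))
... | no i≢1  = inj₂ (inj₂ (flat-NearChrom i {G} {y} near triangleX rep (flat-triangleX i i≢1)))

module _ (m : ℕ) (adj : Fin (suc m) → Fin (suc m) → Bool)
  (adj-sym : ∀ i j → adj i j ≡ adj j i) (adj-irrefl : ∀ i → adj i i ≡ false) where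

  open VertexRemoval m adj adj-sym adj-irrefl

  classify-nonempty : ∀ (a : Fin (suc m)) disjoint → NoDisjointEdges.Shape m adj adj-sym adj-irrefl disjoint →
    ∀ y → NearChrom (G a) y → Classified y
  classify-nonempty _ _ (NoDisjointEdges.starlike a towards away) y = classify-star (G a) y m
    (RepX-centre a (λ u → towards _ (Fin.punchInᵢ≢i a u)) (λ u v → away _ _ (Fin.punchInᵢ≢i a u) (Fin.punchInᵢ≢i a v)))
  classify-nonempty a _ (NoDisjointEdges.triangle refl complete) y =
    classify-triangle (G a) y (RepX-resp-adj C3 {adj} {adj-sym} {adj-irrefl} complete triangleX RepX-C3)
  classify-nonempty _ _ (NoDisjointEdges.isolated m≢0 a none) y near i =
    inj₂ (inj₂ (flat-NearChrom i {G a} {y} near (psum 0 ⊗ x) (RepX-isolated a (λ u → none _) x rep)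
      (flat-psum0⊗ i x (pe0-nonempty (G∖a a) x rep m≢0))))
    where
    open Expansion (G∖a a)
    x : PExpr
    x = expand (allPairs ++ []) discrete
    rep : RepX (G∖a a) x
    rep = RepX-expand []

classify : ∀ G y → NearChrom G y → InΓ y → Classified y
classify G@(record { n = zero })  y near y∈Γ = classify-empty G y refl near
classify G@(record { n = suc m ; adj = adj ; sym = adj-sym ; irrefl = adj-irrefl }) y near y∈Γ =
  classify-nonempty m adj adj-sym adj-irrefl zero (no-disjoint-edges G y near y∈Γ)
    (NoDisjointEdges.shape m adj adj-sym adj-irrefl (no-disjoint-edges G y near y∈Γ)) y near

-- Algebraically independent generating sets of near chromatic symmetric functions

-- On the ray of p_{2i+1}, `rest i` sees only zeros, so `b i` is a nonzero multiple of u plus a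
-- constant.
Triangular-¬flat : ∀ {b} → Triangular b → ∀ i → ¬ Flat i (b i)
Triangular-¬flat {b} Δ i flat = ¬noLinear-linear (coeff i) (coeff≢0 i)
  (noLinear-cong eq (noLinear-+ flat (noLinear-const (- 1ℚ * c))))
  where
  open Triangular Δ
  c : ℚ
  c = pe (λ _ → 0ℚ) (rest i)
  lem : ∀ x c → x ≡ (x + c) + - 1ℚ * c
  lem = solve-∀ ringℚ
  eq : ∀ u → coeff i * u ≡ pe (spike i u) (b i) + - 1ℚ * c
  eq u = trans (lem (coeff i * u) c) (cong (_+ - 1ℚ * c) (sym (trans (split i (spike i u))
    (cong₂ (λ x y → coeff i * x + y) (spike-at i u)
      (pe-cong-supp (rest i) λ r r< → spike-off i u r (ℕ.<⇒≢ (ℕ.<-≤-trans r< (below i))))))))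

triangleY≋̸basisB1 : ¬ (triangleY ≋ basisB 1)
-- At p_3 = 1 and all other power sums 0 the values are 2 and 1.
triangleY≋̸basisB1 e with e (spike 1 1ℚ)
... | ()

≋-flat : ∀ {y y′} i → y ≋ y′ → Flat i y → Flat i y′
≋-flat i e = noLinear-cong (λ u → sym (e (spike i u)))

NearChrom-star⇒≋ : ∀ k {y} → NearChrom (star k) y → y ≋ starY k 0
NearChrom-star⇒≋ k {y} = NearChrom-≋ {star k} {y} (starX k 0) (starY k 0) (RepX-star k) (pe-starY k 0)

≋⇒NearChrom-star : ∀ k {y} → y ≋ starY k 0 → NearChrom (star k) y
≋⇒NearChrom-star k {y} = ≋-NearChrom {star k} {y} (starX k 0) (starY k 0) (RepX-star k) (pe-starY k 0)

SetB⇒≋ : ∀ y → SetB y → Σ ℕ λ i → y ≋ basisB i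
SetB⇒≋ y (k , near) = k , NearChrom-star⇒≋ (2 ℕ.* k) {y} near

≋⇒SetB : ∀ y i → y ≋ basisB i → SetB y
≋⇒SetB y i e = i , ≋⇒NearChrom-star (2 ℕ.* i) {y} e

SetA⇒≋ : ∀ y → SetA y → Σ ℕ λ i → y ≋ basisA i
SetA⇒≋ y (inj₁ near)              = 0 , NearChrom-star⇒≋ 0 {y} near
SetA⇒≋ y (inj₂ (inj₁ near))       = 1 , NearChrom-≋ {C3} {y} triangleX triangleY RepX-C3 pe-triangleY near
SetA⇒≋ y (inj₂ (inj₂ (k , near))) = suc (suc k) , NearChrom-star⇒≋ (2 ℕ.* suc (suc k)) {y} near

≋⇒SetA : ∀ y i → y ≋ basisA i → SetA y
≋⇒SetA y zero          e = inj₁ (≋⇒NearChrom-star 0 {y} e)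
≋⇒SetA y (suc zero)    e = inj₂ (inj₁ (≋-NearChrom {C3} {y} triangleX triangleY RepX-C3 pe-triangleY e))
≋⇒SetA y (suc (suc i)) e = inj₂ (inj₂ (i , ≋⇒NearChrom-star (2 ℕ.* suc (suc i)) {y} e))

OnlyOdd-basisA : ∀ i → OnlyOdd (basisA i)
OnlyOdd-basisA zero          = refl
OnlyOdd-basisA (suc zero)    = (refl , refl , refl) , (refl , refl)
OnlyOdd-basisA (suc (suc i)) = OnlyOdd-starY (2 ℕ.* suc (suc i)) 0

freeGenerators : ∀ (T : SymSet) b → Triangular b → (∀ i → OnlyOdd (b i)) →
  (∀ y → T y → Σ ℕ λ i → y ≋ b i) → (∀ y i → y ≋ b i → T y) → AlgIndep T × GeneratesΓ T
freeGenerators T b Δ odd-b T⇒≋ ≋⇒T = algIndep T T⇒≋ , generates T (λ i → ≋⇒T (b i) i λ _ → refl)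
  λ y Ty → let (i , e) = T⇒≋ y Ty in b i , odd-b i , ≋⇒≈ {y} {b i} e
  where open Triangular Δ using (algIndep; generates)

-- Neither alternative needs to be decidable by itself: the given choices for finitely many j can be
-- searched one by one.
find : ∀ k {P Q : Fin k → Set} → (∀ j → P j ⊎ Q j) → Σ (Fin k) P ⊎ (∀ j → Q j)
find zero    h = inj₂ λ ()
find (suc k) h with h zero | find k (h ∘ suc)
... | inj₁ p | _            = inj₁ (zero , p)
... | inj₂ q | inj₁ (j , p) = inj₁ (suc j , p)
... | inj₂ q | inj₂ qs      = inj₂ λ { zero → q ; (suc j) → qs j }

module Uniqueness (T : SymSet) (resp : Respects≈ T) (chrom : ∀ y → T y → Σ Graph (λ G → NearChrom G y))
  (indep : AlgIndep T) (gen : GeneratesΓ T) where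

  T⇒InΓ : ∀ y → T y → InΓ y
  T⇒InΓ = proj₁ gen

  classified : ∀ y → T y → Classified y
  classified y Ty = classify (proj₁ (chrom y Ty)) y (proj₂ (chrom y Ty)) (T⇒InΓ y Ty)

  -- If all generators used for p_{2i+1} had no linear term along the ray of p_{2i+1}, neither would p_{2i+1}.
  contains : ∀ i → T (basisB i) ⊎ (i ≡ 1 × T triangleY)
  contains i with proj₂ gen (psum (2 ℕ.* i)) (psum (2 ℕ.* i) , even-2* i , λ _ _ → refl)
  ... | k , t , Tt , f , p≈f = conclude (find k λ j → regroup (t j) (Tt j) (classified (t j) (Tt j) i))
    where
    Found : Set
    Found = T (basisB i) ⊎ (i ≡ 1 × T triangleY)
    regroup : ∀ y → T y → (y ≋ basisB i) ⊎ (i ≡ 1 × y ≋ triangleY) ⊎ Flat i y → Found ⊎ Flat i y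
    regroup y Ty (inj₁ e)              = inj₁ (inj₁ (resp y (basisB i) (≋⇒≈ {y} {basisB i} e) Ty))
    regroup y Ty (inj₂ (inj₁ (i≡1 , e))) = inj₁ (inj₂ (i≡1 , resp y triangleY (≋⇒≈ {y} {triangleY} e) Ty))
    regroup y Ty (inj₂ (inj₂ flat))    = inj₂ flat
    conclude : Σ (Fin k) (λ _ → Found) ⊎ (∀ j → Flat i (t j)) → Found
    conclude (inj₁ (_ , found)) = found
    conclude (inj₂ flat) = ⊥-elim (¬noLinear-linear 1ℚ 1≢0 (noLinear-cong
      (λ u → trans (*-identityˡ u) (trans (sym (spike-at i u)) (trans
        (≈⇒≋ {psum (2 ℕ.* i)} {subst k f t} p≈f (spike i u)) (pe-subst k f t (spike i u)))))
      (noLinear-evP k f (λ u j → pe (spike i u) (t j)) flat)))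

  -- The shape of the graph decides: in the flat case equality fails because `basisB i` is not flat,
  -- in the triangle case because the two functions for i = 1 differ.
  B? : ∀ y → T y → ∀ i → Dec (y ≋ basisB i)
  B? y Ty i with classified y Ty i
  ... | inj₁ e                   = yes e
  ... | inj₂ (inj₁ (refl , e))   = no λ e′ → triangleY≋̸basisB1 λ s → trans (sym (e s)) (e′ s)
  ... | inj₂ (inj₂ flat)         = no λ e → Triangular-¬flat triangularB i (≋-flat {y} {basisB i} i e flat)

  A? : ∀ y → T y → ∀ i → Dec (y ≋ basisA i)
  A? y Ty zero          = B? y Ty zero
  A? y Ty (suc (suc i)) = B? y Ty (suc (suc i))
  A? y Ty (suc zero) with classified y Ty 1
  ... | inj₁ e              = no λ e′ → triangleY≋̸basisB1 λ s → trans (sym (e′ s)) (e s)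
  ... | inj₂ (inj₁ (_ , e)) = yes e
  ... | inj₂ (inj₂ flat)    = no λ e → Triangular-¬flat triangularA 1 (≋-flat {y} {triangleY} 1 e flat)

  sameSet : ∀ U b → Triangular b → (∀ y → U y → Σ ℕ λ i → y ≋ b i) → (∀ y i → y ≋ b i → U y) →
    (∀ i → T (b i)) → (∀ y → T y → ∀ i → Dec (y ≋ b i)) → SameSet T U
  sameSet U b Δ U⇒≋ ≋⇒U Tb b? y =
    (λ Ty → let (i , e) = Triangular.maximal Δ T indep Tb y Ty (T⇒InΓ y Ty) (b? y Ty) in ≋⇒U y i e) ,
    (λ Uy → let (i , e) = U⇒≋ y Uy in resp (b i) y (≋⇒≈ {b i} {y} (sym ∘ e)) (Tb i))

  containsB : ∀ i → i ≢ 1 → T (basisB i)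
  containsB i i≢1 with contains i
  ... | inj₁ Tb        = Tb
  ... | inj₂ (i≡1 , _) = ⊥-elim (i≢1 i≡1)

  unique : SameSet T SetA ⊎ SameSet T SetB
  unique with contains 1
  ... | inj₁ Tb₁ = inj₂ (sameSet SetB basisB triangularB SetB⇒≋ ≋⇒SetB
    (λ { zero → containsB 0 (λ ()) ; (suc zero) → Tb₁ ; (suc (suc i)) → containsB (suc (suc i)) (λ ()) }) B?)
  ... | inj₂ (_ , Ttriangle) = inj₁ (sameSet SetA basisA triangularA SetA⇒≋ ≋⇒SetA
    (λ { zero → containsB 0 (λ ()) ; (suc zero) → Ttriangle ; (suc (suc i)) → containsB (suc (suc i)) (λ ()) }) A?)


theorem3p8 : ((AlgIndep SetA × GeneratesΓ SetA) × (AlgIndep SetB × GeneratesΓ SetB)) ×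
    (∀ (T : SymSet) → Respects≈ T →
    (∀ y → T y → Σ Graph (λ G → NearChrom G y)) →
    AlgIndep T → GeneratesΓ T →
    SameSet T SetA ⊎ SameSet T SetB)
theorem3p8 = ( freeGenerators SetA basisA triangularA OnlyOdd-basisA SetA⇒≋ ≋⇒SetA
             , freeGenerators SetB basisB triangularB (λ i → OnlyOdd-starY (2 ℕ.* i) 0) SetB⇒≋ ≋⇒SetB )
           , Uniqueness.unique
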